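{- Let $w$ be a Dyck word in the alphabet $\{V,U\}$, where $U,V$ are subject to the relation $UV=VU+V$, and let $n=|w|/2$. Then for every $k$ with $0\le k\le n$, $$\begin{bmatrix} w\\ k\end{bmatrix}=c(H^d_w,k)=c(G^d_w,k).$$
   Context: Dyck words: a word $w$ in $\{V,U\}$ is a Dyck word if it has as many $V$'s as $U$'s and every prefix contains at least as many $V$'s as $U$'s. $|w|$ is the length of $w$; put $n=|w|/2$. A Dyck word is irreducible if $w=VU$ or $w=Vw'U$ with $w'$ a non-empty Dyck word; otherwise it is reducible. Normal order coefficients: in the associative unital algebra generated by $U,V$ with the relation $UV=VU+V$, a word $w$ with $m$ $V$'s and $n$ $U$'s has a unique expansion $w=V^m\sum_{k=0}^n \begin{bmatrix} w\\ k\end{bmatrix}U^k$; this defines $\begin{bmatrix} w\\ k\end{bmatrix}$. Board $B(w)$: draw in the $n\times n$ lattice a path from the lower left corner, reading $w$ from left to right, with $V$ a unit up step and $U$ a unit right step. $B(w)$ is the set of cells lying above the path. Columns are labeled $1,\dots,n$ from right to left, rows $1,\dots,n$ from top to bottom, and $(i,j)$ is the cell in column $i$ and row $j$. (Thus column $i$ of $B(w)$ consists of the cells $(i,1),\dots,(i,b_i)$, where $b_i$ is the number of $V$'s to the right of the $i$-th $U$ from the right in $w$.) Graph $H_w$: vertex set $\{1,\dots,n\}$; for $i>j$ there is an edge between $i$ and $j$ if and only if $(i,j)\notin B(w)$. Graph $G_w$: built recursively. If $w=VU$, $G_w$ is a single vertex. If $w=Vw'U$ with $w'$ a non-empty Dyck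 word, $G_w$ is $G_{w'}$ with one added vertex adjacent to all others, corresponding to the outer pair $V,U$. If $w=w_1\cdots w_m$ is reducible with each $w_i$ irreducible, $G_w$ is the disjoint union of the $G_{w_i}$. Each $U$ of $w$ thus corresponds to a vertex of $G_w$; number the $U$'s in $w$ by $1,\dots,n$ from right to left and label each vertex by the number of its $U$. $H^d_w$ and $G^d_w$ are the labeled digraphs obtained from $H_w$ and $G_w$ by replacing each edge between $i$ and $j$, $i<j$, by a directed edge from $j$ to $i$. Cyclic partitions: for a permutation $\sigma$ of $\{1,\dots,n\}$, $\sigma^{(i)}$ is the permutation of $\{1,\dots,i\}$ obtained by keeping only the elements $j\le i$ in the cycle structure of $\sigma$. A $k$-cyclic partition of a digraph $G$ with $V(G)=\{1,\dots,n\}$ is a permutation $\sigma$ of $V(G)$ with exactly $k$ cycles (fixed points count as cycles) such that for every vertex $i$, $\sigma^{(i)}(i)=j$ only if there is no directed edge from $i$ to $j$. $c(G,k)$ is the number of $k$-cyclic partitions of $G$. -}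

module Defs where

open import Algebra.Bundles using (CommutativeRing; Ring)
import Algebra.Properties.AbelianGroup
import Algebra.Properties.CommutativeSemigroup
import Algebra.Properties.Ring
import Algebra.Properties.Semiring.Exp
import Algebra.Properties.Semiring.Mult
import Algebra.Properties.Semiring.Sum
open import Data.Empty using (⊥)
open import Data.Fin.Base using (Fin; zero; suc; toℕ; opposite; splitAt)
import Data.Fin.Base as Fin
import Data.Fin.Properties as Fin
open import Data.List.Base
  using (List; []; _∷_; _++_; _∷ʳ_; length; filter; foldr; allFin; cartesianProductWith)
open import Data.List.Properties using (++-assoc)
open import Data.Nat.Base as ℕ using (ℕ; zero; suc; _≤_; _<_; s≤s; s≤s⁻¹)
open import Data.Nat.GeneralisedArithmetic using (fold)
import Data.Nat.Properties as ℕ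
open import Data.Product.Base using (_×_; _,_; proj₁; proj₂)
open import Data.Product using (∃!)
open import Data.Sum.Base using (_⊎_; inj₁; inj₂; swap)
open import Data.Sum.Relation.Binary.Pointwise using (Pointwise; ⊎-decidable; ⊎-symmetric; inj₁; inj₂)
open import Data.Vec.Base as Vec using (Vec; []; _∷_; lookup)
open import Data.Vec.Functional using (Vector)
open import Data.Unit.Base using (⊤; tt)
open import Function.Base using (_on_; _∘_)
open import Level using (_⊔_; 0ℓ)
open import Relation.Binary.Core using (Rel)
open import Relation.Binary.Definitions using (Decidable; Symmetric)
open import Relation.Binary.PropositionalEquality.Core as ≡ using (_≡_; _≢_; refl)
open import Relation.Nullary.Decidable.Core using (Dec; yes; no; ¬?; _×-dec_; _⊎-dec_; _→-dec_)
open import Relation.Nullary.Negation.Core using (¬_; contradiction)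

private
  variable
    n : ℕ

------------------------------------------------------------------------
-- Dyck words

data Letter : Set where
  V U : Letter

Word : Set
Word = List Letter

#V #U : Word → ℕ
#V []      = 0
#V (V ∷ w) = suc (#V w)
#V (U ∷ w) = #V w
#U []      = 0
#U (V ∷ w) = #U w
#U (U ∷ w) = suc (#U w)

private
  variable
    w w₁ w₂ : Word

-- The empty word counts as a Dyck word.
IsDyck : Word → Set
IsDyck w = #V w ≡ #U w × (∀ p s → w ≡ p ++ s → #U p ≤ #V p)

-- So n = |w|/2 is #U w for a Dyck word w.
Dyck⇒length : ∀ w → IsDyck w → length w ≡ 2 ℕ.* #U w
Dyck⇒length w (#V≡#U , _) = ≡.trans (length≡#V+#U w)
  (≡.trans (≡.cong (ℕ._+ #U w) #V≡#U) (≡.cong (#U w ℕ.+_) (≡.sym (ℕ.+-identityʳ _))))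
  where
  length≡#V+#U : ∀ w → length w ≡ #V w ℕ.+ #U w
  length≡#V+#U []      = refl
  length≡#V+#U (V ∷ w) = ≡.cong suc (length≡#V+#U w)
  length≡#V+#U (U ∷ w) = ≡.trans (≡.cong suc (length≡#V+#U w)) (≡.sym (ℕ.+-suc (#V w) (#U w)))

------------------------------------------------------------------------
-- The associative unital K-algebra generated by V and U subject to
-- UV = VU + V, and normal order coefficients.  The ground ring K is an
-- arbitrary commutative ring.

module NormalOrder {a ℓ} (K : CommutativeRing a ℓ) where

  private
    module K = CommutativeRing K
    open K using (0#; 1#) renaming (Carrier to ∣K∣)
    module KG = Algebra.Properties.AbelianGroup K.+-abelianGroup
    module KR = Algebra.Properties.Ring K.ring
    module KA = Algebra.Properties.CommutativeSemigroup K.+-commutativeSemigroup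
    module KM = Algebra.Properties.CommutativeSemigroup K.*-commutativeSemigroup
    module K× = Algebra.Properties.Semiring.Mult K.semiring

  fromℕ : ℕ → ∣K∣
  fromℕ m = m K×.× 1#

  infixl 6 _+_
  infixl 7 _*_
  infix  8 -_
  infix  4 _≈_

  data Term : Set a where
    scalar  : ∣K∣ → Term
    gen     : Letter → Term
    _+_ _*_ : Term → Term → Term
    -_      : Term → Term

  data _≈_ : Rel Term (a ⊔ ℓ) where
    ≈-refl      : ∀ {x} → x ≈ x
    ≈-sym       : ∀ {x y} → x ≈ y → y ≈ x
    ≈-trans     : ∀ {x y z} → x ≈ y → y ≈ z → x ≈ z
    +-cong      : ∀ {x x′ y y′} → x ≈ x′ → y ≈ y′ → x + y ≈ x′ + y′
    *-cong      : ∀ {x x′ y y′} → x ≈ x′ → y ≈ y′ → x * y ≈ x′ * y′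
    -‿cong      : ∀ {x x′} → x ≈ x′ → - x ≈ - x′
    +-assoc     : ∀ x y z → (x + y) + z ≈ x + (y + z)
    +-comm      : ∀ x y → x + y ≈ y + x
    +-identityˡ : ∀ x → scalar 0# + x ≈ x
    -‿inverseˡ  : ∀ x → - x + x ≈ scalar 0#
    *-assoc     : ∀ x y z → (x * y) * z ≈ x * (y * z)
    *-identityˡ : ∀ x → scalar 1# * x ≈ x
    *-identityʳ : ∀ x → x * scalar 1# ≈ x
    distribˡ    : ∀ x y z → x * (y + z) ≈ x * y + x * z
    distribʳ    : ∀ x y z → (y + z) * x ≈ y * x + z * x
    scalar-cong : ∀ {r s} → r K.≈ s → scalar r ≈ scalar s
    scalar-+    : ∀ r s → scalar (r K.+ s) ≈ scalar r + scalar s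
    scalar-*    : ∀ r s → scalar (r K.* s) ≈ scalar r * scalar s
    central     : ∀ r x → scalar r * x ≈ x * scalar r
    UV≈VU+V     : gen U * gen V ≈ gen V * gen U + gen V

  algebra : Ring a (a ⊔ ℓ)
  algebra = record
    { Carrier = Term ; _≈_ = _≈_ ; _+_ = _+_ ; _*_ = _*_ ; -_ = -_
    ; 0# = scalar 0# ; 1# = scalar 1#
    ; isRing = record
      { +-isAbelianGroup = record
        { isGroup = record
          { isMonoid = record
            { isSemigroup = record
              { isMagma = record
                { isEquivalence = record { refl = ≈-refl ; sym = ≈-sym ; trans = ≈-trans }
                ; ∙-cong = +-cong }
              ; assoc = +-assoc }
            ; identity = +-identityˡ , λ x → ≈-trans (+-comm _ _) (+-identityˡ x) }
          ; inverse = -‿inverseˡ , λ x → ≈-trans (+-comm _ _) (-‿inverseˡ x)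
          ; ⁻¹-cong = -‿cong }
        ; comm = +-comm }
      ; *-cong = *-cong
      ; *-assoc = *-assoc
      ; *-identity = *-identityˡ , *-identityʳ
      ; distrib = distribˡ , distribʳ
      }
    }

  private
    module A = Ring algebra
  open Algebra.Properties.Semiring.Exp A.semiring using (_^_)
  open Algebra.Properties.Semiring.Sum A.semiring using (sum; sum-cong-≋; *-distribˡ-sum; *-distribʳ-sum; ∑-distrib-+)

  ⟦_⟧ : Word → Term
  ⟦ w ⟧ = foldr (λ l x → gen l * x) (scalar 1#) w

  normalForm : ℕ → ∀ {n} → Vector ∣K∣ n → Term
  normalForm m {n} a = gen V ^ m * sum {n} (λ k → scalar (a k) * gen U ^ toℕ k)

  IsNormalOrder : (w : Word) → Vector ∣K∣ (suc (#U w)) → Set (a ⊔ ℓ)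
  IsNormalOrder w a = ⟦ w ⟧ ≈ normalForm (#V w) a

  -- Existence: U Vᵐ = Vᵐ (U + m).

  private
    open import Relation.Binary.Reasoning.Setoid A.setoid

    poly : Vector ∣K∣ n → (ℕ → Term) → Term
    poly a f = sum (λ k → scalar (a k) * f (toℕ k))

    UVᵐ : ∀ m → gen U * gen V ^ m ≈ gen V ^ m * (gen U + scalar (fromℕ m))
    UVᵐ zero = begin
      gen U * scalar 1#                  ≈⟨ central 1# (gen U) ⟨
      scalar 1# * gen U                  ≈⟨ *-cong ≈-refl (A.+-identityʳ _) ⟨
      scalar 1# * (gen U + scalar 0#)    ∎
    UVᵐ (suc m) = begin
      gen U * (v * vᵐ)                          ≈⟨ *-assoc _ _ _ ⟨
      (gen U * v) * vᵐ                          ≈⟨ *-cong UV≈VU+V ≈-refl ⟩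
      (v * gen U + v) * vᵐ                      ≈⟨ distribʳ _ _ _ ⟩
      (v * gen U) * vᵐ + v * vᵐ                 ≈⟨ +-cong (*-assoc _ _ _) (≈-sym (*-identityʳ _)) ⟩
      v * (gen U * vᵐ) + v * vᵐ * scalar 1#     ≈⟨ +-cong (*-cong ≈-refl (UVᵐ m)) ≈-refl ⟩
      v * (vᵐ * (gen U + s)) + v * vᵐ * scalar 1# ≈⟨ +-cong (≈-sym (*-assoc _ _ _)) ≈-refl ⟩
      v * vᵐ * (gen U + s) + v * vᵐ * scalar 1# ≈⟨ distribˡ _ _ _ ⟨
      v * vᵐ * (gen U + s + scalar 1#)          ≈⟨ *-cong ≈-refl (≈-trans (+-assoc _ _ _) (+-cong ≈-refl (+-comm _ _))) ⟩
      v * vᵐ * (gen U + (scalar 1# + s))        ≈⟨ *-cong ≈-refl (+-cong ≈-refl (scalar-+ _ _)) ⟨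
      v * vᵐ * (gen U + scalar (fromℕ (suc m)))   ∎
      where
      v  = gen V
      vᵐ = gen V ^ m
      s  = scalar (fromℕ m)

    shift pad : Vector ∣K∣ n → Vector ∣K∣ (suc n)
    shift a zero    = 0#
    shift a (suc k) = a k
    pad {zero}  a zero    = 0#
    pad {suc n} a zero    = a zero
    pad {suc n} a (suc k) = pad (a ∘ suc) k

    poly-shift : ∀ (a : Vector ∣K∣ n) f → poly (shift a) f ≈ poly a (f ∘ suc)
    poly-shift a f = ≈-trans (+-cong (A.zeroˡ _) ≈-refl) (+-identityˡ _)

    poly-pad : ∀ (a : Vector ∣K∣ n) f → poly (pad a) f ≈ poly a f
    poly-pad {zero}  a f = ≈-trans (+-cong (A.zeroˡ _) ≈-refl) (+-identityˡ _)
    poly-pad {suc n} a f = +-cong ≈-refl (poly-pad (a ∘ suc) (f ∘ suc))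

    U*poly : ∀ (a : Vector ∣K∣ n) → gen U * poly a (gen U ^_) ≈ poly a (λ k → gen U ^ suc k)
    U*poly {n} a = ≈-trans (*-distribˡ-sum (gen U) (λ k → scalar (a k) * gen U ^ toℕ k))
      (sum-cong-≋ {n} λ k → ≈-trans (≈-sym (*-assoc _ _ _))
        (≈-trans (*-cong (≈-sym (central _ _)) ≈-refl) (*-assoc _ _ _)))

    scale : ∣K∣ → Vector ∣K∣ n → Vector ∣K∣ n
    scale r a k = r K.* a k

    poly-scale : ∀ r (a : Vector ∣K∣ n) f → poly (scale r a) f ≈ scalar r * poly a f
    poly-scale {n} r a f = ≈-sym (≈-trans (*-distribˡ-sum (scalar r) (λ k → scalar (a k) * f (toℕ k)))
      (sum-cong-≋ {n} λ k → ≈-trans (≈-sym (*-assoc _ _ _)) (*-cong (≈-sym (scalar-* _ _)) ≈-refl)))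

    coefficients : (w : Word) → Vector ∣K∣ (suc (#U w))
    coefficients []      _ = 1#
    coefficients (V ∷ w) k = coefficients w k
    coefficients (U ∷ w) k = shift (coefficients w) k K.+ scale (fromℕ (#V w)) (pad (coefficients w)) k

    coefficients-correct : ∀ w → IsNormalOrder w (coefficients w)
    coefficients-correct [] = begin
      scalar 1#                                          ≈⟨ *-identityˡ _ ⟨
      scalar 1# * scalar 1#                              ≈⟨ *-cong ≈-refl (*-identityˡ _) ⟨
      scalar 1# * (scalar 1# * scalar 1#)                ≈⟨ *-cong ≈-refl (A.+-identityʳ _) ⟨
      scalar 1# * (scalar 1# * scalar 1# + scalar 0#)    ∎
    coefficients-correct (V ∷ w) = ≈-trans (*-cong ≈-refl (coefficients-correct w)) (≈-sym (*-assoc _ _ _))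
    coefficients-correct (U ∷ w) = begin
      gen U * ⟦ w ⟧                           ≈⟨ *-cong ≈-refl (coefficients-correct w) ⟩
      gen U * (vᵐ * p)                        ≈⟨ *-assoc _ _ _ ⟨
      gen U * vᵐ * p                          ≈⟨ *-cong (UVᵐ (#V w)) ≈-refl ⟩
      vᵐ * (gen U + s) * p                    ≈⟨ *-assoc _ _ _ ⟩
      vᵐ * ((gen U + s) * p)                  ≈⟨ *-cong ≈-refl (distribʳ _ _ _) ⟩
      vᵐ * (gen U * p + s * p)                ≈⟨ *-cong ≈-refl (+-cong
                                                   (≈-trans (U*poly c) (≈-sym (poly-shift c (gen U ^_))))
                                                   (≈-sym (≈-trans (poly-scale m (pad c) (gen U ^_))
                                                     (*-cong ≈-refl (poly-pad c (gen U ^_)))))) ⟩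
      vᵐ * (poly (shift c) (gen U ^_) + poly (scale m (pad c)) (gen U ^_))
        ≈⟨ *-cong ≈-refl (∑-distrib-+
             (λ k → scalar (shift c k) * gen U ^ toℕ k)
             (λ k → scalar (scale m (pad c) k) * gen U ^ toℕ k)) ⟨
      vᵐ * sum (λ k → scalar (shift c k) * gen U ^ toℕ k + scalar (scale m (pad c) k) * gen U ^ toℕ k)
        ≈⟨ *-cong ≈-refl (sum-cong-≋ {suc (suc (#U w))} λ k →
             ≈-trans (≈-sym (distribʳ (gen U ^ toℕ k) (scalar (shift c k)) (scalar (scale m (pad c) k))))
               (*-cong (≈-sym (scalar-+ (shift c k) (scale m (pad c) k))) ≈-refl)) ⟩
      vᵐ * poly (coefficients (U ∷ w)) (gen U ^_) ∎
      where
      c  = coefficients w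
      vᵐ = gen V ^ #V w
      p  = poly c (gen U ^_)
      m  = fromℕ (#V w)
      s  = scalar m

  -- Uniqueness: the algebra acts on arrays, where f i j stands for the
  -- coefficient of VⁱUʲ, in the way left multiplication must.

  private
    Array : Set a
    Array = ℕ → ℕ → ∣K∣

    infix 4 _≋_
    _≋_ : Rel Array ℓ
    f ≋ g = ∀ i j → f i j K.≈ g i j

    infixl 6 _⊕_
    _⊕_ : Array → Array → Array
    (f ⊕ g) i j = f i j K.+ g i j

    infixr 7 _⊙_
    _⊙_ : ∣K∣ → Array → Array
    (r ⊙ f) i j = r K.* f i j

    up : Array → Array
    up f i zero    = 0#
    up f i (suc j) = f i j

    act : Term → Array → Array
    act (scalar r) f = r ⊙ f
    act (gen V) f zero    j = 0#
    act (gen V) f (suc i) j = f i j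
    act (gen U) f i j = up f i j K.+ fromℕ i K.* f i j
    act (x + y) f = act x f ⊕ act y f
    act (x * y) f = act x (act y f)
    act (- x) f i j = K.- act x f i j

    up-cong : ∀ {f g} → f ≋ g → up f ≋ up g
    up-cong f≋g i zero    = K.refl
    up-cong f≋g i (suc j) = f≋g i j

    up-⊕ : ∀ f g → up (f ⊕ g) ≋ up f ⊕ up g
    up-⊕ f g i zero    = K.sym (K.+-identityˡ _)
    up-⊕ f g i (suc j) = K.refl

    up-⊙ : ∀ r f → up (r ⊙ f) ≋ r ⊙ up f
    up-⊙ r f i zero    = K.sym (K.zeroʳ _)
    up-⊙ r f i (suc j) = K.refl

    act-congʳ : ∀ x {f g} → f ≋ g → act x f ≋ act x g
    act-congʳ (scalar r) f≋g i j       = K.*-congˡ (f≋g i j)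
    act-congʳ (gen V)    f≋g zero    j = K.refl
    act-congʳ (gen V)    f≋g (suc i) j = f≋g i j
    act-congʳ (gen U)    f≋g i j       = K.+-cong (up-cong f≋g i j) (K.*-congˡ (f≋g i j))
    act-congʳ (x + y)    f≋g i j       = K.+-cong (act-congʳ x f≋g i j) (act-congʳ y f≋g i j)
    act-congʳ (x * y)    f≋g           = act-congʳ x (act-congʳ y f≋g)
    act-congʳ (- x)      f≋g i j       = K.-‿cong (act-congʳ x f≋g i j)

    act-⊕ : ∀ x f g → act x (f ⊕ g) ≋ act x f ⊕ act x g
    act-⊕ (scalar r) f g i j       = K.distribˡ _ _ _
    act-⊕ (gen V)    f g zero    j = K.sym (K.+-identityˡ _)
    act-⊕ (gen V)    f g (suc i) j = K.refl
    act-⊕ (gen U)    f g i j       =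
      K.trans (K.+-cong (up-⊕ f g i j) (K.distribˡ _ _ _)) (KA.interchange _ _ _ _)
    act-⊕ (x + y)    f g i j       =
      K.trans (K.+-cong (act-⊕ x f g i j) (act-⊕ y f g i j)) (KA.interchange _ _ _ _)
    act-⊕ (x * y)    f g i j       =
      K.trans (act-congʳ x (act-⊕ y f g) i j) (act-⊕ x (act y f) (act y g) i j)
    act-⊕ (- x)      f g i j       =
      K.trans (K.-‿cong (act-⊕ x f g i j)) (K.sym (KG.⁻¹-∙-comm _ _))

    act-⊙ : ∀ x r f → act x (r ⊙ f) ≋ r ⊙ act x f
    act-⊙ (scalar s) r f i j       = KM.x∙yz≈y∙xz _ _ _
    act-⊙ (gen V)    r f zero    j = K.sym (K.zeroʳ _)
    act-⊙ (gen V)    r f (suc i) j = K.refl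
    act-⊙ (gen U)    r f i j       =
      K.trans (K.+-cong (up-⊙ r f i j) (KM.x∙yz≈y∙xz _ _ _)) (K.sym (K.distribˡ _ _ _))
    act-⊙ (x + y)    r f i j       =
      K.trans (K.+-cong (act-⊙ x r f i j) (act-⊙ y r f i j)) (K.sym (K.distribˡ _ _ _))
    act-⊙ (x * y)    r f i j       =
      K.trans (act-congʳ x (act-⊙ y r f) i j) (act-⊙ x r (act y f) i j)
    act-⊙ (- x)      r f i j       =
      K.trans (K.-‿cong (act-⊙ x r f i j)) (KR.-‿distribʳ-* _ _)

    act-congˡ : ∀ {x y} → x ≈ y → ∀ f → act x f ≋ act y f
    act-congˡ ≈-refl f i j = K.refl
    act-congˡ (≈-sym p) f i j = K.sym (act-congˡ p f i j)
    act-congˡ (≈-trans p q) f i j = K.trans (act-congˡ p f i j) (act-congˡ q f i j)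
    act-congˡ (+-cong p q) f i j = K.+-cong (act-congˡ p f i j) (act-congˡ q f i j)
    act-congˡ (*-cong {x} p q) f i j =
      K.trans (act-congʳ x (act-congˡ q f) i j) (act-congˡ p _ i j)
    act-congˡ (-‿cong p) f i j = K.-‿cong (act-congˡ p f i j)
    act-congˡ (+-assoc x y z) f i j = K.+-assoc _ _ _
    act-congˡ (+-comm x y) f i j = K.+-comm _ _
    act-congˡ (+-identityˡ x) f i j = K.trans (K.+-congʳ (K.zeroˡ _)) (K.+-identityˡ _)
    act-congˡ (-‿inverseˡ x) f i j = K.trans (K.-‿inverseˡ _) (K.sym (K.zeroˡ _))
    act-congˡ (*-assoc x y z) f i j = K.refl
    act-congˡ (*-identityˡ x) f i j = K.*-identityˡ _
    act-congˡ (*-identityʳ x) f i j = act-congʳ x (λ _ _ → K.*-identityˡ _) i j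
    act-congˡ (distribˡ x y z) f i j = act-⊕ x _ _ i j
    act-congˡ (distribʳ x y z) f i j = K.refl
    act-congˡ (scalar-cong r≈s) f i j = K.*-congʳ r≈s
    act-congˡ (scalar-+ r s) f i j = K.distribʳ _ _ _
    act-congˡ (scalar-* r s) f i j = K.*-assoc _ _ _
    act-congˡ (central r x) f i j = K.sym (act-⊙ x r f i j)
    act-congˡ UV≈VU+V f zero j =
      K.trans (K.+-cong (up-V j) (K.zeroʳ _)) K.refl
      where
      up-V : ∀ j → up (act (gen V) f) zero j K.≈ 0#
      up-V zero    = K.refl
      up-V (suc j) = K.refl
    act-congˡ UV≈VU+V f (suc i) j =
      K.trans (K.+-cong (up-V j) (K.trans (K.distribʳ _ _ _) (K.trans (K.+-comm _ _) (K.+-congˡ (K.*-identityˡ _)))))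
              (K.sym (K.+-assoc _ _ _))
      where
      up-V : ∀ j → up (act (gen V) f) (suc i) j K.≈ up f i j
      up-V zero    = K.refl
      up-V (suc j) = K.refl

    δ : ℕ → Array
    δ l zero    j with l ℕ.≟ j
    ... | yes _ = 1#
    ... | no  _ = 0#
    δ l (suc i) j = 0#

    act-Uᵏ : ∀ l → act (gen U ^ l) (δ 0) ≋ δ l
    act-Uᵏ zero    i j = K.*-identityˡ _
    act-Uᵏ (suc l) i j = K.trans (act-congʳ (gen U) (act-Uᵏ l) i j) (step i j)
      where
      step : act (gen U) (δ l) ≋ δ (suc l)
      step zero zero = K.trans (K.+-identityˡ _) (K.zeroˡ _)
      step zero (suc j) with l ℕ.≟ j | suc l ℕ.≟ suc j
      ... | yes _ | yes _ = K.trans (K.+-congˡ (K.zeroˡ _)) (K.+-identityʳ _)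
      ... | no  _ | no  _ = K.trans (K.+-congˡ (K.zeroˡ _)) (K.+-identityʳ _)
      ... | yes p | no ¬q = contradiction (≡.cong suc p) ¬q
      ... | no ¬p | yes q = contradiction (ℕ.suc-injective q) ¬p
      step (suc i) zero    = K.trans (K.+-identityˡ _) (K.zeroʳ _)
      step (suc i) (suc j) = K.trans (K.+-identityˡ _) (K.zeroʳ _)

    act-Vᵐ : ∀ m f j → act (gen V ^ m) f m j K.≈ f 0 j
    act-Vᵐ zero    f j = K.*-identityˡ _
    act-Vᵐ (suc m) f j = act-Vᵐ m f j

    act-poly : ∀ (a : Vector ∣K∣ n) l k → act (poly a (λ j → gen U ^ (l ℕ.+ j))) (δ 0) 0 (l ℕ.+ toℕ k) K.≈ a k
    act-poly-below : ∀ (a : Vector ∣K∣ n) l j → j < l → act (poly a (λ j → gen U ^ (l ℕ.+ j))) (δ 0) 0 j K.≈ 0#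

    δ-off : ∀ {l j} → l ≢ j → δ l 0 j K.≈ 0#
    δ-off {l} {j} l≢j with l ℕ.≟ j
    ... | yes l≡j = contradiction l≡j l≢j
    ... | no  _   = K.refl

    δ-on : ∀ {l j} → l ≡ j → δ l 0 j K.≈ 1#
    δ-on {l} {j} l≡j with l ℕ.≟ j
    ... | yes _  = K.refl
    ... | no l≢j = contradiction l≡j l≢j

    reindex : ∀ {n} (a : Vector ∣K∣ n) l f i j →
      act (poly a (λ j → gen U ^ (l ℕ.+ suc j))) f i j K.≈ act (poly a (λ j → gen U ^ (suc l ℕ.+ j))) f i j
    reindex {n} a l f i j = act-congˡ (sum-cong-≋ {n} λ k →
      *-cong ≈-refl (A.reflexive (≡.cong (gen U ^_) (ℕ.+-suc l (toℕ k))))) f i j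

    act-poly {suc n} a l zero = K.trans (K.+-cong
      (K.trans (K.*-congˡ (K.trans (act-Uᵏ (l ℕ.+ 0) 0 (l ℕ.+ 0)) (δ-on {l ℕ.+ 0} refl))) (K.*-identityʳ _))
      (K.trans (reindex (a ∘ suc) l (δ 0) 0 (l ℕ.+ 0))
        (act-poly-below (a ∘ suc) (suc l) (l ℕ.+ 0) (s≤s (ℕ.≤-reflexive (ℕ.+-identityʳ l))))))
      (K.+-identityʳ _)
    act-poly {suc n} a l (suc k) = K.trans (K.+-cong
      (K.trans (K.*-congˡ (K.trans (act-Uᵏ (l ℕ.+ 0) 0 _) (δ-off {l ℕ.+ 0} (λ p → contradiction (ℕ.+-cancelˡ-≡ l 0 _ p) λ ())))) (K.zeroʳ _))
      (K.trans (reindex (a ∘ suc) l (δ 0) 0 (l ℕ.+ suc (toℕ k)))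
        (K.trans (K.reflexive (≡.cong (act (poly (a ∘ suc) (λ j → gen U ^ (suc l ℕ.+ j))) (δ 0) 0) (ℕ.+-suc l (toℕ k))))
          (act-poly (a ∘ suc) (suc l) k))))
      (K.+-identityˡ _)

    act-poly-below {zero}  a l j j<l = K.zeroˡ _
    act-poly-below {suc n} a l j j<l = K.trans (K.+-cong
      (K.trans (K.*-congˡ (K.trans (act-Uᵏ (l ℕ.+ 0) 0 j) (δ-off {l ℕ.+ 0} (λ p → ℕ.<⇒≢ j<l (≡.trans (≡.sym p) (ℕ.+-identityʳ l)))))) (K.zeroʳ _))
      (K.trans (reindex (a ∘ suc) l (δ 0) 0 j) (act-poly-below (a ∘ suc) (suc l) j (ℕ.m<n⇒m<1+n j<l))))
      (K.+-identityˡ _)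

    act-normalForm : ∀ m (a : Vector ∣K∣ n) k → act (normalForm m a) (δ 0) m (toℕ k) K.≈ a k
    act-normalForm m a k = K.trans (act-Vᵐ m _ (toℕ k)) (act-poly a 0 k)

  normalOrder : ∀ w → ∃! (λ a b → ∀ k → a k K.≈ b k) (IsNormalOrder w)
  normalOrder w = coefficients w , coefficients-correct w , λ {b} w≈b k →
    K.trans (K.sym (act-normalForm (#V w) (coefficients w) k))
      (K.trans (act-congˡ (≈-trans (≈-sym (coefficients-correct w)) w≈b) (δ 0) (#V w) (toℕ k))
        (act-normalForm (#V w) b k))

  [_,_] : (w : Word) → Fin (suc (#U w)) → ∣K∣
  [ w , k ] = proj₁ (normalOrder w) k

------------------------------------------------------------------------
-- Graphs and digraphs on {1,…,n}, with the vertex i encoded as the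
-- element of Fin n whose value is i - 1.

record Graph : Set₁ where
  field
    order      : ℕ
    Adjacent   : Rel (Fin order) 0ℓ
    adjacent?  : Decidable Adjacent
    symmetric  : Symmetric Adjacent
    loopless   : ∀ {i} → ¬ Adjacent i i

record Digraph : Set₁ where
  field
    order : ℕ
    _⟶_   : Rel (Fin order) 0ℓ
    _⟶?_  : Decidable _⟶_

infix 9 _ᵈ

_ᵈ : Graph → Digraph
G ᵈ = record
  { order = order
  ; _⟶_   = λ j i → i Fin.< j × Adjacent i j
  ; _⟶?_  = λ j i → (i Fin.<? j) ×-dec adjacent? i j
  }
  where open Graph G

------------------------------------------------------------------------
-- The board B(w) and the graph H_w

-- The i-th entry is the number of V's to the right of the i-th U from
-- the left.
V-counts : (w : Word) → Vec ℕ (#U w)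
V-counts []      = []
V-counts (V ∷ w) = V-counts w
V-counts (U ∷ w) = #V w ∷ V-counts w

columnHeight : (w : Word) → Fin (#U w) → ℕ
columnHeight w i = lookup (V-counts w) (opposite i)

-- Column i is numbered from the right and row j from the top.
Board : (w : Word) → Rel (Fin (#U w)) 0ℓ
Board w i j = toℕ j < columnHeight w i

board? : (w : Word) → Decidable (Board w)
board? w i j = toℕ j ℕ.<? columnHeight w i

H : Word → Graph
H w = record
  { order     = #U w
  ; Adjacent  = λ i j → (j Fin.< i × ¬ Board w i j) ⊎ (i Fin.< j × ¬ Board w j i)
  ; adjacent? = λ i j → ((j Fin.<? i) ×-dec ¬? (board? w i j)) ⊎-dec ((i Fin.<? j) ×-dec ¬? (board? w j i))
  ; symmetric = swap
  ; loopless  = λ { (inj₁ (i<i , _)) → ℕ.<-irrefl refl i<i ; (inj₂ (i<i , _)) → ℕ.<-irrefl refl i<i }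
  }

------------------------------------------------------------------------
-- The graph G_w

mutual
  data Irreducible : Word → Set where
    VU   : Irreducible (V ∷ U ∷ [])
    wrap : w ≢ [] → Factorisation w → Irreducible (V ∷ w ∷ʳ U)

  data Factorisation : Word → Set where
    []  : Factorisation []
    _∷_ : Irreducible w₁ → Factorisation w₂ → Factorisation (w₁ ++ w₂)

private
  -- A word whose up-steps fall short by h: factorised words separated
  -- by h unmatched letters U.
  data Unmatched : ℕ → Word → Set where
    done : Factorisation w → Unmatched 0 w
    step : ∀ {h} → Factorisation w₁ → Unmatched h w₂ → Unmatched (suc h) (w₁ ++ U ∷ w₂)

  enclose : Factorisation w → Irreducible (V ∷ w ∷ʳ U)
  enclose {[]}    _ = VU
  enclose {_ ∷ _} f = wrap (λ ()) f

  prepend : ∀ {h} → Irreducible w₁ → Unmatched h w₂ → Unmatched h (w₁ ++ w₂)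
  prepend d (done f) = done (d ∷ f)
  prepend {w₁} d (step {w₁ = w₂} {w₂ = w₃} f r) =
    ≡.subst (Unmatched _) (++-assoc w₁ w₂ (U ∷ w₃)) (step (d ∷ f) r)

  close : ∀ {h} → Unmatched (suc h) w → Unmatched h (V ∷ w)
  close (step {w₁} {w₂} f r) =
    ≡.subst (Unmatched _) (≡.cong (V ∷_) (++-assoc w₁ (U ∷ []) w₂)) (prepend (enclose f) r)

  parse : ∀ h w → h ℕ.+ #V w ≡ #U w → (∀ p s → w ≡ p ++ s → #U p ≤ h ℕ.+ #V p) → Unmatched h w
  parse zero    []      _  _    = done []
  parse (suc h) []      () _
  parse h       (V ∷ w) eq pref = close (parse (suc h) w (≡.trans (≡.sym (ℕ.+-suc h (#V w))) eq)
    λ p s w≡ → ≡.subst (#U p ≤_) (ℕ.+-suc h (#V p)) (pref (V ∷ p) s (≡.cong (V ∷_) w≡)))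
  parse zero    (U ∷ w) eq pref = contradiction (pref (U ∷ []) w refl) λ ()
  parse (suc h) (U ∷ w) eq pref = step [] (parse h w (ℕ.suc-injective eq)
    λ p s w≡ → s≤s⁻¹ (pref (U ∷ p) s (≡.cong (U ∷_) w≡)))

factorise : IsDyck w → Factorisation w
factorise {w} (#V≡#U , prefix) with done f ← parse 0 w #V≡#U prefix = f

emptyGraph point : Graph
emptyGraph = record
  { order = 0 ; Adjacent = λ _ _ → ⊥ ; adjacent? = λ _ _ → no λ () ; symmetric = λ () ; loopless = λ () }
point = record
  { order = 1 ; Adjacent = λ _ _ → ⊥ ; adjacent? = λ _ _ → no λ () ; symmetric = λ () ; loopless = λ () }

-- The added vertex gets the smallest label.
cone : Graph → Graph
cone G = record
  { order     = suc order
  ; Adjacent  = Adj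
  ; adjacent? = adj?
  ; symmetric = λ {i} {j} → adj-sym i j
  ; loopless  = λ {i} → adj-irr i
  }
  where
  open Graph G
  Adj : Rel (Fin (suc order)) 0ℓ
  Adj zero    zero    = ⊥
  Adj zero    (suc _) = ⊤
  Adj (suc _) zero    = ⊤
  Adj (suc i) (suc j) = Adjacent i j
  adj? : Decidable Adj
  adj? zero    zero    = no λ ()
  adj? zero    (suc _) = yes tt
  adj? (suc _) zero    = yes tt
  adj? (suc i) (suc j) = adjacent? i j
  adj-sym : ∀ i j → Adj i j → Adj j i
  adj-sym zero    (suc _) _ = tt
  adj-sym (suc _) zero    _ = tt
  adj-sym (suc i) (suc j) e = symmetric e
  adj-irr : ∀ i → ¬ Adj i i
  adj-irr zero    ()
  adj-irr (suc i) e = loopless e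

-- The disjoint union, with the labels of the left graph before those of
-- the right one.
infixr 5 _⊎ᴳ_

_⊎ᴳ_ : Graph → Graph → Graph
G₁ ⊎ᴳ G₂ = record
  { order     = G₁.order ℕ.+ G₂.order
  ; Adjacent  = Pointwise G₁.Adjacent G₂.Adjacent on splitAt G₁.order
  ; adjacent? = λ i j → ⊎-decidable G₁.adjacent? G₂.adjacent? (splitAt G₁.order i) (splitAt G₁.order j)
  ; symmetric = ⊎-symmetric G₁.symmetric G₂.symmetric
  ; loopless  = λ {i} → irr (splitAt G₁.order i)
  }
  where
  module G₁ = Graph G₁
  module G₂ = Graph G₂
  irr : ∀ x → ¬ Pointwise G₁.Adjacent G₂.Adjacent x x
  irr (inj₁ _) (inj₁ e) = G₁.loopless e
  irr (inj₂ _) (inj₂ e) = G₂.loopless e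

-- The letters U are numbered from right to left, so the outer U of Vw'U
-- comes first, and the U's of w₂ precede those of w₁ in w₁w₂.
mutual
  graphᴵ : Irreducible w → Graph
  graphᴵ VU         = point
  graphᴵ (wrap _ f) = cone (graph f)

  graph : Factorisation w → Graph
  graph []      = emptyGraph
  graph (d ∷ f) = graph f ⊎ᴳ graphᴵ d

G : (w : Word) → IsDyck w → Graph
G w dyck = graph (factorise dyck)

G-order : ∀ w (dyck : IsDyck w) → Graph.order (G w dyck) ≡ #U w
G-order _ dyck = graph-order (factorise dyck)
  where
  #U-++ : ∀ w₁ w₂ → #U (w₁ ++ w₂) ≡ #U w₂ ℕ.+ #U w₁
  #U-++ []       w₂ = ≡.sym (ℕ.+-identityʳ _)
  #U-++ (V ∷ w₁) w₂ = #U-++ w₁ w₂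
  #U-++ (U ∷ w₁) w₂ = ≡.trans (≡.cong suc (#U-++ w₁ w₂)) (≡.sym (ℕ.+-suc (#U w₂) (#U w₁)))

  graphᴵ-order : (d : Irreducible w) → Graph.order (graphᴵ d) ≡ #U w
  graph-order  : (f : Factorisation w) → Graph.order (graph f) ≡ #U w
  graphᴵ-order VU = refl
  graphᴵ-order (wrap {w} _ f) = ≡.trans (≡.cong suc (graph-order f)) (≡.sym (#U-++ w (U ∷ [])))
  graph-order [] = refl
  graph-order (_∷_ {w₁} {w₂} d f) =
    ≡.trans (≡.cong₂ ℕ._+_ (graph-order f) (graphᴵ-order d)) (≡.sym (#U-++ w₁ w₂))

------------------------------------------------------------------------
-- Cyclic partitions

-- A permutation is given by the vector of its values.
IsPermutation : Vec (Fin n) n → Set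
IsPermutation σ = ∀ x y → lookup σ x ≡ lookup σ y → x ≡ y

-- Cutting m out of its cycle; the value at m itself is irrelevant.
delete : Fin n → (Fin n → Fin n) → (Fin n → Fin n)
delete m σ x with σ x Fin.≟ m
... | yes _ = σ m
... | no  _ = σ x

-- The permutation σ⁽ⁱ⁾ of the elements up to i.
restrict : Vec (Fin n) n → Fin n → (Fin n → Fin n)
restrict {n} σ i = foldr delete (lookup σ) (filter (i Fin.<?_) (allFin n))

-- Cycles are counted by their least elements.  The first n iterates of
-- a permutation of Fin n already exhaust the cycle of x.
IsLeastInCycle : Vec (Fin n) n → Fin n → Set
IsLeastInCycle {n} σ x = ∀ (t : Fin n) → x Fin.≤ fold x (lookup σ) (toℕ t)

isLeastInCycle? : (σ : Vec (Fin n) n) (x : Fin n) → Dec (IsLeastInCycle σ x)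
isLeastInCycle? σ x = Fin.all? λ t → x Fin.≤? fold x (lookup σ) (toℕ t)

#cycles : Vec (Fin n) n → ℕ
#cycles {n} σ = length (filter (isLeastInCycle? σ) (allFin n))

module _ (D : Digraph) where
  open Digraph D

  IsCyclicPartition : ℕ → Vec (Fin order) order → Set
  IsCyclicPartition k σ =
    IsPermutation σ × #cycles σ ≡ k × (∀ i → ¬ i ⟶ restrict σ i i)

  isCyclicPartition? : ∀ k σ → Dec (IsCyclicPartition k σ)
  isCyclicPartition? k σ =
    Fin.all? (λ x → Fin.all? λ y → (lookup σ x Fin.≟ lookup σ y) →-dec (x Fin.≟ y))
    ×-dec (#cycles σ ℕ.≟ k)
    ×-dec Fin.all? (λ i → ¬? (i ⟶? restrict σ i i))

allVecs : ∀ m n → List (Vec (Fin m) n)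
allVecs m zero    = [] ∷ []
allVecs m (suc n) = cartesianProductWith _∷_ (allFin m) (allVecs m n)

c : Digraph → ℕ → ℕ
c D k = length (filter (isCyclicPartition? D k) (allVecs order order))
  where open Digraph D

{-# OPTIONS --safe #-}

-- All three sides are the coefficient of xᵏ in ∏ (x + dᵢ), where dᵢ is the
-- number of V's to the right of the i-th U.  For the normal order this is
-- U Vᵐ = Vᵐ (U + m).  For a digraph with all edges pointing to smaller labels,
-- build a cyclic partition by inserting 1, 2, … in turn: i either starts a
-- new cycle or is inserted before one of the smaller j without edge i ⟶ j.
-- In H_w and in G_w there are dᵢ such j.
module Submission where

open import Defs
open import Algebra.Bundles using (CommutativeRing; Ring)
import Algebra.Properties.Semiring.Exp
import Algebra.Properties.Semiring.Mult
import Algebra.Properties.Semiring.Sum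
open import Data.Fin.Base using (Fin; zero; suc; toℕ; fromℕ<; inject₁; opposite; _↑ˡ_; _↑ʳ_)
import Data.Fin.Base as Fin
import Data.Fin.Properties as Fin
open import Data.Fin.Permutation.Components using (transpose)
open import Data.List.Base
  using (List; []; _∷_; _++_; _∷ʳ_; map; length; filter; foldr; allFin; cartesianProduct; reverse; tabulate)
open import Data.List.Properties
open import Data.List.Membership.Propositional using (_∈_; _∉_)
open import Data.List.Membership.Propositional.Properties
open import Data.List.Membership.Propositional.Properties.WithK using (unique∧set⇒bag)
open import Data.List.Relation.Binary.BagAndSetEquality using (∼bag⇒↭)
open import Data.List.Relation.Binary.Permutation.Propositional.Properties using (↭-length)
open import Data.List.Relation.Unary.All as All using (All; []; _∷_)
open import Data.List.Relation.Unary.AllPairs using (AllPairs; []; _∷_)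
import Data.List.Relation.Unary.AllPairs.Properties as AllPairs
open import Data.List.Relation.Unary.Any using (here; there)
open import Data.List.Relation.Unary.Unique.Propositional using (Unique)
import Data.List.Relation.Unary.Unique.Propositional.Properties as Unique
open import Data.Nat.Base as ℕ using (ℕ; zero; suc; _≤_; _<_; z≤n; _+_; _*_; _∸_)
open import Data.Nat.DivMod using (_%_; _/_; m≡m%n+[m/n]*n; m%n<n)
open import Data.Nat.GeneralisedArithmetic using (fold; fold-+)
import Data.Nat.Properties as ℕ
open import Data.Product.Base using (∃; _×_; _,_; proj₁; proj₂; uncurry)
open import Data.Sum.Base using (_⊎_; inj₁; inj₂)
open import Data.Sum.Relation.Binary.Pointwise using (inj₁; inj₂)
open import Data.Vec.Base as Vec using (Vec; lookup)
import Data.Vec.Properties as Vec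
open import Function.Base using (_∘_; id; case_of_)
open import Function.Bundles using (mk⇔)
open import Relation.Binary.PropositionalEquality
  using (_≡_; _≢_; refl; sym; trans; cong; cong₂; subst; subst₂; module ≡-Reasoning)
open import Relation.Nullary.Decidable.Core using (yes; no; ¬?; _×-dec_; decidable-stable)
open import Relation.Nullary.Negation.Core using (¬_; contradiction)
open import Relation.Unary using (Pred; Decidable)

-- All comparisons go through lists of numbers in one fixed order: U's from left to right, that is
-- labels from `n` down to 1. The leftmost U is the last to be moved past the V's, and label `n` is
-- the last vertex to be inserted, so both recursions peel off the same head. The lists obtained for
-- `H`, for `G` and for the normal order are therefore equal, not merely rearrangements of each
-- other; this is why lists over vertices are reversed.
--
-- The delicate point is σ⁽ⁱ⁾, which is defined by deleting the larger elements one at a time from a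
-- permutation of all vertices. Partial cyclic partitions are therefore kept as permutations of all
-- vertices. Inserting `i` before `j` is then the exchange of two values, an involution, so one
-- operation both inserts and removes, and it must be shown not to disturb σ⁽ˣ⁾(x) for `x` below
-- `i`.

private
  variable
    n : ℕ

-- Filtered counts and lists without repetition.

module _ {a} {A : Set a} where

  length-filter-cong : ∀ {p q} {P : Pred A p} {Q : Pred A q} (P? : Decidable P) (Q? : Decidable Q) xs →
    (∀ {x} → x ∈ xs → (P x → Q x) × (Q x → P x)) → length (filter P? xs) ≡ length (filter Q? xs)
  length-filter-cong P? Q? [] P⇔Q = refl
  length-filter-cong P? Q? (x ∷ xs) P⇔Q with P? x | Q? x
  ... | yes _ | yes _ = cong suc (length-filter-cong P? Q? xs (P⇔Q ∘ there))
  ... | no  _ | no  _ = length-filter-cong P? Q? xs (P⇔Q ∘ there)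
  ... | yes p | no ¬q = contradiction (proj₁ (P⇔Q (here refl)) p) ¬q
  ... | no ¬p | yes q = contradiction (proj₂ (P⇔Q (here refl)) q) ¬p

  length-filter-insert : ∀ {p q} {P : Pred A p} {Q : Pred A q} (P? : Decidable P) (Q? : Decidable Q) {m xs} →
    Unique xs → m ∈ xs → P m → ¬ Q m → (∀ {x} → x ≢ m → (P x → Q x) × (Q x → P x)) →
    length (filter P? xs) ≡ suc (length (filter Q? xs))
  length-filter-insert P? Q? {m} {_ ∷ xs} (m∉ ∷ _) (here refl) pm ¬qm P⇔Q with P? m | Q? m
  ... | yes _ | no  _ = cong suc (length-filter-cong P? Q? xs λ x∈ → P⇔Q λ { refl → All.lookup m∉ x∈ refl })
  ... | _     | yes q = contradiction q ¬qm
  ... | no ¬p | _     = contradiction pm ¬p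
  length-filter-insert P? Q? {xs = x ∷ _} (x∉ ∷ u) (there m∈) pm ¬qm P⇔Q with P? x | Q? x | P⇔Q {x} (All.lookup x∉ m∈)
  ... | yes _ | yes _ | _     = cong suc (length-filter-insert P? Q? u m∈ pm ¬qm P⇔Q)
  ... | no  _ | no  _ | _     = length-filter-insert P? Q? u m∈ pm ¬qm P⇔Q
  ... | yes p | no ¬q | f , _ = contradiction (f p) ¬q
  ... | no ¬p | yes q | _ , g = contradiction (g q) ¬p

  -- Injectivity is asked for only on the members of the list: `swapValues i j σ` determines `j` and
  -- `σ` only when `σ` is known to fix `i`.
  map-unique : ∀ {b} {B : Set b} {f : A → B} {xs} →
    (∀ {x y} → x ∈ xs → y ∈ xs → f x ≡ f y → x ≡ y) → Unique xs → Unique (map f xs)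
  map-unique {xs = []} inj [] = []
  map-unique {f = f} {xs = x ∷ xs} inj (x∉ ∷ u) =
    All.tabulate (λ z∈ fx≡z → let y , y∈ , z≡fy = ∈-map⁻ f z∈ in
      All.lookup x∉ y∈ (inj (here refl) (there y∈) (trans fx≡z z≡fy)))
    ∷ map-unique (λ x∈ y∈ → inj (there x∈) (there y∈)) u

  length-cartesianProduct : ∀ {b} {B : Set b} (xs : List A) (ys : List B) →
    length (cartesianProduct xs ys) ≡ length xs * length ys
  length-cartesianProduct []       ys = refl
  length-cartesianProduct (x ∷ xs) ys = trans (length-++ (map (x ,_) ys))
    (cong₂ _+_ (length-map (x ,_) ys) (length-cartesianProduct xs ys))

-- Transpositions

transpose-left : ∀ (i j : Fin n) → transpose i j i ≡ j
transpose-left i j with i Fin.≟ i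
... | yes _  = refl
... | no i≢i = contradiction refl i≢i

transpose-right : ∀ (i j : Fin n) → transpose i j j ≡ i
transpose-right i j with j Fin.≟ i
... | yes j≡i = j≡i
... | no  _ with j Fin.≟ j
...   | yes _  = refl
...   | no j≢j = contradiction refl j≢j

transpose-other : ∀ {i j k : Fin n} → k ≢ i → k ≢ j → transpose i j k ≡ k
transpose-other {i = i} {j} {k} k≢i k≢j with k Fin.≟ i
... | yes k≡i = contradiction k≡i k≢i
... | no  _ with k Fin.≟ j
...   | yes k≡j = contradiction k≡j k≢j
...   | no  _   = refl

transpose-involutive : ∀ (i j k : Fin n) → transpose i j (transpose i j k) ≡ k
transpose-involutive i j k = go (k Fin.≟ i) (k Fin.≟ j)
  where
  go : _ → _ → _
  go (yes refl) _ = trans (cong (transpose i j) (transpose-left i j)) (transpose-right i j)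
  go (no _) (yes refl) = trans (cong (transpose i j) (transpose-right i j)) (transpose-left i j)
  go (no k≢i) (no k≢j) = trans (cong (transpose i j) (transpose-other k≢i k≢j)) (transpose-other k≢i k≢j)

transpose-injective : ∀ (i j : Fin n) {k l} → transpose i j k ≡ transpose i j l → k ≡ l
transpose-injective i j {k} {l} eq =
  trans (sym (transpose-involutive i j k)) (trans (cong (transpose i j) eq) (transpose-involutive i j l))

-- Cycles

fold-cancel : {f : Fin n → Fin n} → (∀ x y → f x ≡ f y → x ≡ y) →
  ∀ x i p → fold x f i ≡ fold x f (i + p) → x ≡ fold x f p
fold-cancel inj x zero    p eq = eq
fold-cancel inj x (suc i) p eq = fold-cancel inj x i p (inj _ _ eq)

fold-multiple : {f : Fin n → Fin n} {x : Fin n} (p : ℕ) → x ≡ fold x f p → ∀ q → fold x f (q * p) ≡ x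
fold-multiple p eq zero = refl
fold-multiple {f = f} {x} p eq (suc q) =
  trans (fold-+ x f p) (trans (cong (λ y → fold y f p) (fold-multiple p eq q)) (sym eq))

-- The definition inspects only the first `n` iterates. Two of the iterates 0 to `n` coincide, which
-- by injectivity gives a period `p` with `p ≤ n`, and `t` may be replaced by `t % p`.
least-fold : (σ : Vec (Fin n) n) → IsPermutation σ → ∀ {x} → IsLeastInCycle σ x →
  ∀ t → x Fin.≤ fold x (lookup σ) t
least-fold {n} σ inj {x} least t with Fin.pigeonhole (ℕ.n<1+n n) (λ t → fold x (lookup σ) (toℕ t))
... | i , j , i<j , eq = subst (x Fin.≤_) (sym fold-t) (subst (λ r → x Fin.≤ fold x f r) (Fin.toℕ-fromℕ< r<n) (least (fromℕ< r<n)))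
  where
  f = lookup σ
  p = toℕ j ∸ toℕ i
  instance
    p≢0 : ℕ.NonZero p
    p≢0 = ℕ.>-nonZero (ℕ.m<n⇒0<n∸m i<j)
  period : x ≡ fold x f p
  period = fold-cancel inj x (toℕ i) p (trans eq (cong (fold x f) (sym (ℕ.m+[n∸m]≡n (ℕ.<⇒≤ i<j)))))
  r<n : t % p < n
  r<n = ℕ.<-≤-trans (m%n<n t p) (ℕ.≤-trans (ℕ.m∸n≤m (toℕ j) (toℕ i)) (ℕ.s≤s⁻¹ (Fin.toℕ<n j)))
  fold-t : fold x f t ≡ fold x f (t % p)
  fold-t = trans (cong (fold x f) (m≡m%n+[m/n]*n t p))
    (trans (fold-+ x f (t % p)) (cong (λ y → fold y f (t % p)) (fold-multiple p period (t / p))))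

-- If σ fixes i, this inserts i into the cycle of j, just before j.
swapValues : (i j : Fin n) → Vec (Fin n) n → Vec (Fin n) n
swapValues i j = Vec.map (transpose i j)

swapValues-involutive : ∀ (i j : Fin n) σ → swapValues i j (swapValues i j σ) ≡ σ
swapValues-involutive i j σ = trans (sym (Vec.map-∘ (transpose i j) (transpose i j) σ))
  (trans (Vec.map-cong (transpose-involutive i j) σ) (Vec.map-id σ))

swapValues-permutation : ∀ (i j : Fin n) σ → IsPermutation σ → IsPermutation (swapValues i j σ)
swapValues-permutation i j σ inj x y eq = inj x y (transpose-injective i j
  (trans (sym (Vec.lookup-map x (transpose i j) σ)) (trans eq (Vec.lookup-map y (transpose i j) σ))))

module Insertion {n} {m j : Fin n} (σ : Vec (Fin n) n)
  (inj : IsPermutation σ) (σm≡m : lookup σ m ≡ m) (j<m : j Fin.< m) where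

  private
    f = lookup σ
    σ′ = swapValues m j σ
    g = lookup σ′

    g-def : ∀ x → g x ≡ transpose m j (f x)
    g-def x = Vec.lookup-map x (transpose m j) σ

    f≢m : ∀ {x} → x ≢ m → f x ≢ m
    f≢m x≢m fx≡m = x≢m (inj _ _ (trans fx≡m (sym σm≡m)))

    g-at-preimage : ∀ {x} → f x ≡ j → g x ≡ m
    g-at-preimage {x} fx≡j = trans (g-def x) (trans (cong (transpose m j) fx≡j) (transpose-right m j))

    g-elsewhere : ∀ {x} → x ≢ m → f x ≢ j → g x ≡ f x
    g-elsewhere {x} x≢m fx≢j = trans (g-def x) (transpose-other (f≢m x≢m) fx≢j)

  value : g m ≡ j
  value = trans (g-def m) (trans (cong (transpose m j) σm≡m) (transpose-left m j))

  private
    fold-f≢m : ∀ {x} → x ≢ m → ∀ t → fold x f t ≢ m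
    fold-f≢m x≢m zero    = x≢m
    fold-f≢m x≢m (suc t) = f≢m (fold-f≢m x≢m t)

    f-orbit⊆g-orbit : ∀ {x} → x ≢ m → ∀ t → ∃ λ s → fold x g s ≡ fold x f t
    f-orbit⊆g-orbit x≢m zero = 0 , refl
    f-orbit⊆g-orbit {x} x≢m (suc t) with f-orbit⊆g-orbit x≢m t | f (fold x f t) Fin.≟ j
    -- Where `f` steps to `j`, `g` makes a detour through `m`, hence two steps.
    ... | s , eq | yes fy≡j = suc (suc s) ,
      trans (cong g (trans (cong g eq) (g-at-preimage fy≡j))) (trans value (sym fy≡j))
    ... | s , eq | no  fy≢j = suc s , trans (cong g eq) (g-elsewhere (fold-f≢m x≢m t) fy≢j)

    -- The case of `m` also records that `j` lies on the `f`-orbit: the next `g`-step returns there,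
    -- and a lower bound for the `f`-orbit carries over to `m` because `j < m`.
    g-orbit⊆f-orbit∪m : ∀ {x} → x ≢ m → ∀ s →
      (∃ λ t → fold x g s ≡ fold x f t) ⊎ (fold x g s ≡ m × ∃ λ t → j ≡ fold x f t)
    g-orbit⊆f-orbit∪m x≢m zero = inj₁ (0 , refl)
    g-orbit⊆f-orbit∪m {x} x≢m (suc s) with g-orbit⊆f-orbit∪m x≢m s
    ... | inj₂ (eq , t , j≡) = inj₁ (t , trans (cong g eq) (trans value j≡))
    ... | inj₁ (t , eq) with f (fold x f t) Fin.≟ j
    ...   | yes fy≡j = inj₂ (trans (cong g eq) (g-at-preimage fy≡j) , suc t , sym fy≡j)
    ...   | no  fy≢j = inj₁ (suc t , trans (cong g eq) (g-elsewhere (fold-f≢m x≢m t) fy≢j))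

    m-least-before : IsLeastInCycle σ m
    m-least-before t = ℕ.≤-reflexive (cong toℕ (sym (fixed (toℕ t))))
      where
      fixed : ∀ t → fold m f t ≡ m
      fixed zero    = refl
      fixed (suc t) = trans (cong f (fixed t)) σm≡m

    inj′ : IsPermutation σ′
    inj′ = swapValues-permutation m j σ inj

    m-not-least-after : ¬ IsLeastInCycle σ′ m
    m-not-least-after least = ℕ.<⇒≱ j<m (subst (m Fin.≤_) value (least-fold σ′ inj′ least 1))

    least-iff : ∀ {x} → x ≢ m → (IsLeastInCycle σ x → IsLeastInCycle σ′ x) × (IsLeastInCycle σ′ x → IsLeastInCycle σ x)
    least-iff {x} x≢m = to , from
      where
      to : IsLeastInCycle σ x → IsLeastInCycle σ′ x
      to least s with g-orbit⊆f-orbit∪m x≢m (toℕ s)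
      ... | inj₁ (t , eq) = subst (x Fin.≤_) (sym eq) (least-fold σ inj least t)
      ... | inj₂ (eq , t , j≡) = subst (x Fin.≤_) (sym eq)
        (ℕ.≤-trans (subst (x Fin.≤_) (sym j≡) (least-fold σ inj least t)) (ℕ.<⇒≤ j<m))
      from : IsLeastInCycle σ′ x → IsLeastInCycle σ x
      from least t with f-orbit⊆g-orbit x≢m (toℕ t)
      ... | s , eq = subst (x Fin.≤_) eq (least-fold σ′ inj′ least s)

  -- Before the insertion `m` is the least element of its own cycle; afterwards its cycle contains
  -- the smaller `j`. All other least elements stay, since `m` joins a cycle that already has a
  -- smaller element.
  cycles : #cycles σ ≡ suc (#cycles σ′)
  cycles = length-filter-insert (isLeastInCycle? σ) (isLeastInCycle? σ′) (Unique.allFin⁺ n) (∈-allFin m)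
    m-least-before m-not-least-after least-iff

-- Restrictions

delete-hit : ∀ {m : Fin n} {f : Fin n → Fin n} {x} → f x ≡ m → delete m f x ≡ f m
delete-hit {m = m} {f} {x} fx≡m with f x Fin.≟ m
... | yes _   = refl
... | no fx≢m = contradiction fx≡m fx≢m

delete-miss : ∀ {m : Fin n} {f : Fin n → Fin n} {x} → f x ≢ m → delete m f x ≡ f x
delete-miss {m = m} {f} {x} fx≢m with f x Fin.≟ m
... | yes fx≡m = contradiction fx≡m fx≢m
... | no _     = refl

delete-local : ∀ {m : Fin n} {f g : Fin n → Fin n} {x} → f x ≡ g x → f m ≡ g m → delete m f x ≡ delete m g x
delete-local {m = m} {f} {g} {x} fx≡gx fm≡gm with f x Fin.≟ m
... | yes fx≡m = trans fm≡gm (sym (delete-hit {f = g} (trans (sym fx≡gx) fx≡m)))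
... | no  fx≢m = trans fx≡gx (sym (delete-miss {f = g} (fx≢m ∘ trans fx≡gx)))

-- By injectivity only `l` itself is mapped to a fixed point `l`, so deleting `l` redirects no other
-- element.
deletes-fixed : ∀ {f : Fin n → Fin n} → (∀ x y → f x ≡ f y → x ≡ y) → ∀ {xs x} →
  All (λ l → f l ≡ l) xs → x ∉ xs → foldr delete f xs x ≡ f x
deletes-fixed inj [] x∉ = refl
deletes-fixed {f = f} inj {l ∷ xs} {x} (fl≡l ∷ fixed) x∉ = trans
  (delete-miss {f = foldr delete f xs} λ eq → x∉ (here (inj x l (trans (sym ih) (trans eq (sym fl≡l))))))
  ih
  where ih = deletes-fixed inj fixed (x∉ ∘ there)

-- A deletion of `l` at `x` reads the function only at `x` and at `l`, and both lie below `m`.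
deletes-local : ∀ {m : Fin n} {f g : Fin n → Fin n} → (∀ {x} → x Fin.< m → f x ≡ g x) → ∀ {ys} →
  All (Fin._< m) ys → ∀ {x} → x Fin.< m → foldr delete f ys x ≡ foldr delete g ys x
deletes-local f≗g [] x<m = f≗g x<m
deletes-local {f = f} {g} f≗g {l ∷ ys} (l<m ∷ ys<m) x<m = delete-local {f = foldr delete f ys} {foldr delete g ys}
  (deletes-local f≗g ys<m x<m) (deletes-local f≗g ys<m l<m)

sorted-split : ∀ (ys : List (Fin n)) {m : Fin n} {zs} → AllPairs Fin._<_ (ys ++ m ∷ zs) → All (Fin._< m) ys × All (m Fin.<_) zs
sorted-split []       (m<zs ∷ _) = [] , m<zs
sorted-split (y ∷ ys) (y< ∷ rest) with sorted-split ys rest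
... | ys<m , m<zs = All.lookup y< (∈-++⁺ʳ ys (here refl)) ∷ ys<m , m<zs

restrict-top : ∀ (σ : Vec (Fin n) n) → IsPermutation σ → ∀ {i} →
  (∀ x → i Fin.< x → lookup σ x ≡ x) → restrict σ i i ≡ lookup σ i
restrict-top {n} σ inj {i} fixed = deletes-fixed inj
  (All.tabulate λ {x} x∈ → fixed x (proj₂ (∈-filter⁻ (i Fin.<?_) {xs = allFin n} x∈)))
  (λ i∈ → ℕ.<-irrefl refl (proj₂ (∈-filter⁻ (i Fin.<?_) {xs = allFin n} i∈)))

-- `foldr` deletes the largest elements first. Those above `m` are fixed points and have no effect,
-- the deletion of `m` undoes the insertion, and the remaining deletions see functions that agree
-- below `m`.
restrict-swapValues : ∀ {m j : Fin n} (σ : Vec (Fin n) n) → IsPermutation σ →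
  (∀ x → m Fin.≤ x → lookup σ x ≡ x) → j Fin.< m →
  ∀ {i} → i Fin.< m → restrict (swapValues m j σ) i i ≡ restrict σ i i
restrict-swapValues {n} {m} {j} σ inj fixed j<m {i} i<m
  with ∈-∃++ (∈-filter⁺ (i Fin.<?_) (∈-allFin m) i<m)
... | ys , zs , eq rewrite eq
  | foldr-++ delete (lookup (swapValues m j σ)) ys (m ∷ zs) | foldr-++ delete (lookup σ) ys (m ∷ zs) =
  deletes-local agree (proj₁ split) i<m
  where
  σ′ = swapValues m j σ
  f = lookup σ
  g = lookup σ′
  split : All (Fin._< m) ys × All (m Fin.<_) zs
  split = sorted-split ys (subst (AllPairs Fin._<_) eq
    (AllPairs.filter⁺ (i Fin.<?_) (AllPairs.tabulate⁺-< λ i<j → i<j)))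
  m<zs = proj₂ split

  g-def : ∀ x → g x ≡ transpose m j (f x)
  g-def x = Vec.lookup-map x (transpose m j) σ

  fixed′ : ∀ x → m Fin.< x → g x ≡ x
  fixed′ x m<x = trans (g-def x) (trans (cong (transpose m j) (fixed x (ℕ.<⇒≤ m<x)))
    (transpose-other (λ { refl → ℕ.<-irrefl refl m<x }) λ { refl → ℕ.<-asym m<x j<m }))

  ∉zs : ∀ {x} → x Fin.≤ m → x ∉ zs
  ∉zs x≤m x∈ = ℕ.<⇒≱ (All.lookup m<zs x∈) x≤m

  -- Below `m` the functions differ only at the preimage of `j`; there `g` gives `m`, which the
  -- deletion replaces by `g m`, that is `j`.
  delete-m : ∀ {x} → x Fin.< m → delete m g x ≡ f x
  delete-m {x} x<m with f x Fin.≟ j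
  ... | yes fx≡j = trans (delete-hit {f = g} (trans (g-def x) (trans (cong (transpose m j) fx≡j) (transpose-right m j))))
    (trans (Insertion.value σ inj (fixed m ℕ.≤-refl) j<m) (sym fx≡j))
  ... | no  fx≢j = trans (delete-miss {f = g} (λ gx≡m → fx≢m (trans (sym gx≡fx) gx≡m))) gx≡fx
    where
    fx≢m : f x ≢ m
    fx≢m fx≡m = ℕ.<⇒≢ x<m (cong toℕ (inj x m (trans fx≡m (sym (fixed m ℕ.≤-refl)))))
    gx≡fx : g x ≡ f x
    gx≡fx = trans (g-def x) (transpose-other fx≢m fx≢j)

  inj′ = swapValues-permutation m j σ inj

  agree : ∀ {x} → x Fin.< m → foldr delete g (m ∷ zs) x ≡ foldr delete f (m ∷ zs) x
  agree {x} x<m = trans (delete-local {f = foldr delete g zs} {g}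
      (deletes-fixed inj′ (All.map (λ {l} → fixed′ l) m<zs) (∉zs (ℕ.<⇒≤ x<m)))
      (deletes-fixed inj′ (All.map (λ {l} → fixed′ l) m<zs) (∉zs ℕ.≤-refl)))
    (trans (delete-m x<m) (sym (deletes-fixed inj
      (All.map (λ {l} → fixed l) (ℕ.≤-refl ∷ All.map ℕ.<⇒≤ m<zs))
      λ { (here refl) → ℕ.<-irrefl refl x<m ; (there x∈) → ∉zs (ℕ.<⇒≤ x<m) x∈ })))

-- The coefficient of xᵏ in ∏ (x + d).
coefficient : List ℕ → ℕ → ℕ
coefficient []       zero    = 1
coefficient []       (suc k) = 0
coefficient (d ∷ ds) zero    = d * coefficient ds zero
coefficient (d ∷ ds) (suc k) = coefficient ds k + d * coefficient ds (suc k)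

-- Cyclic partitions by successive insertion.

target? : ∀ D (i : Fin (Digraph.order D)) → Decidable (λ j → j Fin.< i × ¬ Digraph._⟶_ D i j)
target? D i j = (j Fin.<? i) ×-dec ¬? (Digraph._⟶?_ D i j)

-- The values allowed for σ⁽ⁱ⁾(i), apart from i itself.
targets : ∀ D → Fin (Digraph.order D) → List (Fin (Digraph.order D))
targets D i = filter (target? D i) (allFin (Digraph.order D))

∈-targets⁻ : ∀ D {i j} → j ∈ targets D i → j Fin.< i × ¬ Digraph._⟶_ D i j
∈-targets⁻ D {i} j∈ = proj₂ (∈-filter⁻ (target? D i) {xs = allFin (Digraph.order D)} j∈)

module Levels (D : Digraph) (irreflexive : ∀ {i} → ¬ Digraph._⟶_ D i i) where
  open Digraph D renaming (order to N)

  -- The cyclic partitions of the vertices below m, extended to permutations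
  -- of all vertices by fixed points; the latter are included in the count k.
  record Level (m k : ℕ) (σ : Vec (Fin N) N) : Set where
    constructor level
    field
      permutation : IsPermutation σ
      fixed       : ∀ x → m ≤ toℕ x → lookup σ x ≡ x
      cycles      : #cycles σ ≡ k
      avoids      : ∀ i → toℕ i < m → ¬ i ⟶ restrict σ i i

  identity : Vec (Fin N) N
  identity = Vec.allFin N

  -- The new vertex either stays a fixed point or is inserted before a target. As a fixed point it
  -- already counts as a cycle, which insertion merges into another one; hence `suc k` in
  -- `inserted`. The bounds are irrelevant arguments, so the lists do not depend on their proofs.
  levels : ∀ m → .(m ≤ N) → ℕ → List (Vec (Fin N) N)
  inserted : ∀ m → .(m < N) → ℕ → List (Vec (Fin N) N)
  levels zero    _   k with N ℕ.≟ k
  ... | yes _ = identity ∷ []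
  ... | no  _ = []
  levels (suc m) m<N k = levels m (ℕ.<⇒≤ m<N) k ++ inserted m m<N k
  inserted m m<N k = map (uncurry (swapValues (fromℕ< m<N)))
    (cartesianProduct (targets D (fromℕ< m<N)) (levels m (ℕ.<⇒≤ m<N) (suc k)))

  lookup-identity : ∀ x → lookup identity x ≡ x
  lookup-identity = Vec.lookup-allFin

  identity-level : Level 0 N identity
  identity-level = level
    (λ x y eq → trans (sym (lookup-identity x)) (trans eq (lookup-identity y)))
    (λ x _ → lookup-identity x)
    (trans (cong length {y = allFin N} (filter-all (isLeastInCycle? identity) (All.universal (λ x t → ℕ.≤-reflexive (cong toℕ (sym (fold-identity x (toℕ t))))) _)))
      (length-tabulate {n = N} _))
    (λ _ ())
    where
    fold-identity : ∀ x t → fold x (lookup identity) t ≡ x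
    fold-identity x zero    = refl
    fold-identity x (suc t) = trans (lookup-identity _) (fold-identity x t)

  -- The new vertex opens a cycle of its own, so its restricted value is the vertex itself; this is
  -- allowed because the digraph has no loops.
  weaken : ∀ {m k σ} → Level m k σ → Level (suc m) k σ
  weaken {m} {σ = σ} (level perm fix cyc av) = level perm (λ x m<x → fix x (ℕ.<⇒≤ m<x)) cyc av′
    where
    av′ : ∀ i → toℕ i < suc m → ¬ i ⟶ restrict σ i i
    av′ i i≤m with ℕ.m≤n⇒m<n∨m≡n (ℕ.s≤s⁻¹ i≤m)
    ... | inj₁ i<m  = av i i<m
    ... | inj₂ refl = irreflexive ∘ subst (i ⟶_) (trans
      (restrict-top σ perm (λ x i<x → fix x (ℕ.<⇒≤ i<x))) (fix i ℕ.≤-refl))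

  strengthen : ∀ {i k σ} → lookup σ i ≡ i → Level (suc (toℕ i)) k σ → Level (toℕ i) k σ
  strengthen {i} {σ = σ} σi≡i (level perm fix cyc av) = level perm fix′ cyc (λ x x<i → av x (ℕ.m<n⇒m<1+n x<i))
    where
    fix′ : ∀ x → toℕ i ≤ toℕ x → lookup σ x ≡ x
    fix′ x i≤x with ℕ.m≤n⇒m<n∨m≡n i≤x
    ... | inj₁ i<x = fix x i<x
    ... | inj₂ i≡x rewrite Fin.toℕ-injective i≡x = σi≡i

  insert : ∀ {i j k σ} → j Fin.< i → ¬ i ⟶ j → Level (toℕ i) (suc k) σ → Level (suc (toℕ i)) k (swapValues i j σ)
  insert {i} {j} {k} {σ} j<i i↛j (level perm fix cyc av) = level perm′ fix′
    (ℕ.suc-injective (trans (sym I.cycles) cyc)) av′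
    where
    module I = Insertion σ perm (fix i ℕ.≤-refl) j<i
    perm′ = swapValues-permutation i j σ perm
    fix′ : ∀ x → i Fin.< x → lookup (swapValues i j σ) x ≡ x
    fix′ x i<x = trans (Vec.lookup-map x (transpose i j) σ) (trans (cong (transpose i j) (fix x (ℕ.<⇒≤ i<x)))
      (transpose-other (λ { refl → ℕ.<-irrefl refl i<x }) λ { refl → ℕ.<-asym i<x j<i }))
    av′ : ∀ x → toℕ x < suc (toℕ i) → ¬ x ⟶ restrict (swapValues i j σ) x x
    av′ x x≤i with ℕ.m≤n⇒m<n∨m≡n (ℕ.s≤s⁻¹ x≤i)
    ... | inj₁ x<i = av x x<i ∘ subst (x ⟶_) (restrict-swapValues σ perm fix j<i x<i)
    ... | inj₂ x≡i rewrite Fin.toℕ-injective x≡i =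
      i↛j ∘ subst (i ⟶_) (trans (restrict-top (swapValues i j σ) perm′ fix′) I.value)

  -- The inverse of `insert`. The value at `i` cannot exceed `i`, since the vertices above are fixed
  -- and `σ` is injective. The facts about insertion are applied to the swapped vector, from which a
  -- second swap recovers `σ`.
  remove : ∀ {i k σ} → lookup σ i ≢ i → Level (suc (toℕ i)) k σ →
    let j = lookup σ i in j Fin.< i × ¬ i ⟶ j × Level (toℕ i) (suc k) (swapValues i j σ)
  remove {i} {k} {σ} σi≢i (level perm fix cyc av) = j<i , i↛j ,
    level perm′ fix′ (trans I.cycles (cong suc (trans (cong #cycles (swapValues-involutive i j σ)) cyc))) av′
    where
    j = lookup σ i
    σ′ = swapValues i j σ
    j<i : j Fin.< i
    j<i = ℕ.≰⇒> λ i≤j → case ℕ.m≤n⇒m<n∨m≡n i≤j of λ where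
      (inj₁ i<j) → σi≢i (perm j i (fix j i<j))
      (inj₂ i≡j) → σi≢i (sym (Fin.toℕ-injective i≡j))
    i↛j : ¬ i ⟶ j
    i↛j = av i ℕ.≤-refl ∘ subst (i ⟶_) (sym (restrict-top σ perm fix))
    perm′ = swapValues-permutation i j σ perm
    fix′ : ∀ x → toℕ i ≤ toℕ x → lookup σ′ x ≡ x
    fix′ x i≤x with ℕ.m≤n⇒m<n∨m≡n i≤x
    ... | inj₁ i<x = trans (Vec.lookup-map x (transpose i j) σ) (trans (cong (transpose i j) (fix x i<x))
      (transpose-other (λ { refl → ℕ.<-irrefl refl i<x }) λ x≡j → ℕ.<-asym i<x (subst (Fin._< i) (sym x≡j) j<i)))
    ... | inj₂ i≡x rewrite sym (Fin.toℕ-injective i≡x) =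
      trans (Vec.lookup-map i (transpose i j) σ) (transpose-right i j)
    module I = Insertion σ′ perm′ (fix′ i ℕ.≤-refl) j<i
    av′ : ∀ x → toℕ x < toℕ i → ¬ x ⟶ restrict σ′ x x
    av′ x x<i = av x (ℕ.m<n⇒m<1+n x<i) ∘ subst (x ⟶_) (sym (trans
      (cong (λ τ → restrict τ x x) (sym (swapValues-involutive i j σ)))
      (restrict-swapValues σ′ perm′ fix′ j<i x<i)))

  ∈-levels⁻ : ∀ m .(m≤N : m ≤ N) {k σ} → σ ∈ levels m m≤N k → Level m k σ
  ∈-inserted⁻ : ∀ m .(m<N : m < N) {k τ} → τ ∈ inserted m m<N k →
    ∃ λ j → ∃ λ σ → j ∈ targets D (fromℕ< m<N) × Level m (suc k) σ × τ ≡ swapValues (fromℕ< m<N) j σ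
  ∈-levels⁻ zero m≤N {k} σ∈ with N ℕ.≟ k
  ∈-levels⁻ zero m≤N (here refl) | yes refl = identity-level
  ∈-levels⁻ (suc m) m<N {k} σ∈ with ∈-++⁻ (levels m (ℕ.<⇒≤ m<N) k) σ∈
  ... | inj₁ σ∈ = weaken (∈-levels⁻ m (ℕ.<⇒≤ m<N) σ∈)
  ... | inj₂ σ∈ with ∈-inserted⁻ m m<N σ∈
  ...   | j , σ , j∈ , lev , refl = subst (λ m → Level (suc m) k (swapValues i j σ)) (Fin.toℕ-fromℕ< m<N)
    (insert (proj₁ (∈-targets⁻ D j∈)) (proj₂ (∈-targets⁻ D j∈)) (subst (λ m → Level m (suc k) σ) (sym (Fin.toℕ-fromℕ< m<N)) lev))
    where i = fromℕ< m<N
  ∈-inserted⁻ m m<N {k} τ∈ with ∈-map⁻ (uncurry (swapValues (fromℕ< m<N))) τ∈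
  ... | (j , σ) , jσ∈ , eq with ∈-cartesianProduct⁻ (targets D (fromℕ< m<N)) (levels m (ℕ.<⇒≤ m<N) (suc k)) jσ∈
  ...   | j∈ , σ∈ = j , σ , j∈ , ∈-levels⁻ m (ℕ.<⇒≤ m<N) σ∈ , eq

  ∈-levels⁺ : ∀ m .(m≤N : m ≤ N) {k σ} → Level m k σ → σ ∈ levels m m≤N k
  ∈-levels⁺ zero m≤N {k} {σ} (level _ fix cyc _) with σ≡id ← trans (sym (Vec.tabulate∘lookup σ)) (Vec.tabulate-cong (λ x → fix x z≤n))
    with N ℕ.≟ k
  ... | yes refl = here σ≡id
  ... | no  N≢k  = contradiction (trans (sym (Level.cycles identity-level)) (trans (cong #cycles (sym σ≡id)) cyc)) N≢k
  ∈-levels⁺ (suc m) m<N {k} {σ} lev with lookup σ (fromℕ< m<N) Fin.≟ fromℕ< m<N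
  ... | yes σi≡i = ∈-++⁺ˡ (∈-levels⁺ m (ℕ.<⇒≤ m<N) (subst (λ m → Level m k σ) (Fin.toℕ-fromℕ< m<N)
    (strengthen σi≡i (subst (λ m → Level (suc m) k σ) (sym (Fin.toℕ-fromℕ< m<N)) lev))))
  ... | no  σi≢i with remove σi≢i (subst (λ m → Level (suc m) k σ) (sym (Fin.toℕ-fromℕ< m<N)) lev)
  ...   | j<i , i↛j , lev′ = ∈-++⁺ʳ (levels m (ℕ.<⇒≤ m<N) k)
    (subst (_∈ inserted m m<N k) (swapValues-involutive i (lookup σ i) σ)
      (∈-map⁺ (uncurry (swapValues i)) (∈-cartesianProduct⁺
        (∈-filter⁺ (target? D i) (∈-allFin _) (j<i , i↛j))
        (∈-levels⁺ m (ℕ.<⇒≤ m<N) (subst (λ m → Level m (suc k) (swapValues i (lookup σ i) σ)) (Fin.toℕ-fromℕ< m<N) lev′)))))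
    where i = fromℕ< m<N

  private
    inserted-value : ∀ {m} .(m<N : m < N) {k σ j} → Level m k σ → lookup (swapValues (fromℕ< m<N) j σ) (fromℕ< m<N) ≡ j
    inserted-value m<N {σ = σ} {j} lev = trans (Vec.lookup-map i (transpose i j) σ)
      (trans (cong (transpose i j) (Level.fixed lev i (ℕ.≤-reflexive (sym (Fin.toℕ-fromℕ< m<N))))) (transpose-left i j))
      where i = fromℕ< m<N

  -- The value at the new vertex reveals its history: the vertex itself if it was left fixed,
  -- otherwise the `j` before which it was inserted. Knowing `j`, the swap can be undone.
  levels-unique : ∀ m .(m≤N : m ≤ N) k → Unique (levels m m≤N k)
  levels-unique zero m≤N k with N ℕ.≟ k
  ... | yes _ = [] ∷ []
  ... | no  _ = []
  levels-unique (suc m) m<N k = Unique.++⁺ (levels-unique m (ℕ.<⇒≤ m<N) k)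
    (map-unique injective (Unique.cartesianProduct⁺
      (Unique.filter⁺ (target? D i) (Unique.allFin⁺ N))
      (levels-unique m (ℕ.<⇒≤ m<N) (suc k))))
    λ (old , new) → disjoint (∈-levels⁻ m (ℕ.<⇒≤ m<N) old) (∈-inserted⁻ m m<N new)
    where
    i = fromℕ< m<N
    injective : ∀ {p q} → p ∈ cartesianProduct (targets D i) (levels m (ℕ.<⇒≤ m<N) (suc k)) →
      q ∈ cartesianProduct (targets D i) (levels m (ℕ.<⇒≤ m<N) (suc k)) →
      uncurry (swapValues i) p ≡ uncurry (swapValues i) q → p ≡ q
    injective {j , σ} {j′ , σ′} p∈ q∈ eq
      with ∈-cartesianProduct⁻ (targets D i) (levels m (ℕ.<⇒≤ m<N) (suc k)) p∈
         | ∈-cartesianProduct⁻ (targets D i) (levels m (ℕ.<⇒≤ m<N) (suc k)) q∈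
    ... | _ , σ∈ | _ , σ′∈
      with refl ← trans (sym (inserted-value m<N (∈-levels⁻ m (ℕ.<⇒≤ m<N) σ∈)))
             (trans (cong (λ τ → lookup τ i) eq) (inserted-value m<N (∈-levels⁻ m (ℕ.<⇒≤ m<N) σ′∈)))
      = cong (j ,_) (trans (sym (swapValues-involutive i j σ)) (trans (cong (swapValues i j) eq) (swapValues-involutive i j σ′)))
    disjoint : ∀ {τ} → Level m k τ →
      ¬ (∃ λ j → ∃ λ σ → j ∈ targets D i × Level m (suc k) σ × τ ≡ swapValues i j σ)
    disjoint lev (j , σ , j∈ , lev′ , refl) = ℕ.<⇒≢ (proj₁ (∈-targets⁻ D j∈)) (cong toℕ
      (trans (sym (inserted-value m<N lev′)) (Level.fixed lev i (ℕ.≤-reflexive (sym (Fin.toℕ-fromℕ< m<N))))))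

  length-levels-suc : ∀ m .(m<N : m < N) k → length (levels (suc m) m<N k) ≡
    length (levels m (ℕ.<⇒≤ m<N) k) + length (targets D (fromℕ< m<N)) * length (levels m (ℕ.<⇒≤ m<N) (suc k))
  length-levels-suc m m<N k = trans (length-++ (levels m (ℕ.<⇒≤ m<N) k))
    (cong (length (levels m (ℕ.<⇒≤ m<N) k) +_) (trans (length-map (uncurry (swapValues (fromℕ< m<N)))
        (cartesianProduct (targets D (fromℕ< m<N)) (levels m (ℕ.<⇒≤ m<N) (suc k))))
      (length-cartesianProduct (targets D (fromℕ< m<N)) (levels m (ℕ.<⇒≤ m<N) (suc k)))))

  -- Each of the elements from m on is a cycle of its own.
  levels-few-cycles : ∀ m .(m≤N : m ≤ N) {k} → m + k < N → length (levels m m≤N k) ≡ 0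
  levels-few-cycles zero m≤N {k} k<N with N ℕ.≟ k
  ... | yes refl = contradiction refl (ℕ.<⇒≢ k<N)
  ... | no  _    = refl
  levels-few-cycles (suc m) m<N {k} lt
    rewrite length-levels-suc m m<N k
          | levels-few-cycles m (ℕ.<⇒≤ m<N) (ℕ.<-trans (ℕ.n<1+n (m + k)) lt)
          | levels-few-cycles m (ℕ.<⇒≤ m<N) (subst (_< N) (sym (ℕ.+-suc m k)) lt)
    = ℕ.*-zeroʳ (length (targets D (fromℕ< m<N)))

  below : ∀ m → .(m ≤ N) → List (Fin N)
  below zero    _   = []
  below (suc m) m<N = fromℕ< m<N ∷ below m (ℕ.<⇒≤ m<N)

  degrees : ∀ m → .(m ≤ N) → List ℕ
  degrees m m≤N = map (length ∘ targets D) (below m m≤N)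

  -- The `r` vertices not yet reached are cycles by themselves, so cycle numbers are shifted by `r`.
  -- For the constant term the summand with the new vertex fixed vanishes by `levels-few-cycles`.
  length-levels : ∀ m .(m≤N : m ≤ N) r k → m + r ≡ N → length (levels m m≤N (r + k)) ≡ coefficient (degrees m m≤N) k
  length-levels zero m≤N r k refl with r ℕ.≟ r + k
  length-levels zero m≤N r zero    refl | yes _ = refl
  length-levels zero m≤N r (suc k) refl | yes r≡r+k = contradiction (trans (ℕ.+-identityʳ r) r≡r+k) (λ eq → case ℕ.+-cancelˡ-≡ r 0 (suc k) eq of λ ())
  length-levels zero m≤N r zero    refl | no r≢r+0 = contradiction (sym (ℕ.+-identityʳ r)) r≢r+0
  length-levels zero m≤N r (suc k) refl | no _ = refl
  length-levels (suc m) m<N r zero eq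
    rewrite length-levels-suc m m<N (r + 0)
          | levels-few-cycles m (ℕ.<⇒≤ m<N) {r + 0} (ℕ.≤-reflexive (trans (cong (λ r → suc (m + r)) (ℕ.+-identityʳ r)) eq))
          | length-levels m (ℕ.<⇒≤ m<N) (suc r) 0 (trans (ℕ.+-suc m r) eq)
    = refl
  length-levels (suc m) m<N r (suc k) eq
    rewrite length-levels-suc m m<N (r + suc k)
          | length-levels m (ℕ.<⇒≤ m<N) (suc r) (suc k) (trans (ℕ.+-suc m r) eq)
          -- Rereads `r + suc k` as `suc r + k`: a vertex left fixed passes from the `r` reserved
          -- cycles to the `k` counted ones.
          | ℕ.+-suc r k
          | length-levels m (ℕ.<⇒≤ m<N) (suc r) k (trans (ℕ.+-suc m r) eq)
    = refl

-- The number of cyclic partitions as a coefficient.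

allVecs-unique : ∀ m n → Unique (allVecs m n)
allVecs-unique m zero    = [] ∷ []
allVecs-unique m (suc n) = Unique.cartesianProductWith⁺ Vec._∷_ Vec.∷-injective (Unique.allFin⁺ m) (allVecs-unique m n)

∈-allVecs : ∀ {m n} (v : Vec (Fin m) n) → v ∈ allVecs m n
∈-allVecs Vec.[]      = here refl
∈-allVecs (x Vec.∷ v) = ∈-cartesianProductWith⁺ Vec._∷_ (∈-allFin x) (∈-allVecs v)

reverse-tabulate-suc : ∀ {a} {A : Set a} {n} (f : Fin (suc n) → A) →
  reverse (tabulate f) ≡ f (Fin.fromℕ n) ∷ reverse (tabulate (f ∘ inject₁))
reverse-tabulate-suc {n = zero}  f = refl
reverse-tabulate-suc {n = suc n} f = trans (unfold-reverse (f zero) (tabulate (f ∘ suc)))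
  (trans (cong (_∷ʳ f zero) (reverse-tabulate-suc (f ∘ suc)))
    (cong (f (Fin.fromℕ (suc n)) ∷_) (sym (unfold-reverse (f zero) (tabulate (f ∘ suc ∘ inject₁))))))

module _ (D : Digraph) (irreflexive : ∀ {i} → ¬ Digraph._⟶_ D i i) where
  open Digraph D renaming (order to N)
  open Levels D irreflexive

  below-inject : ∀ m (m≤N : m ≤ N) → below m m≤N ≡ reverse (tabulate (λ i → Fin.inject≤ i m≤N))
  below-inject zero    m≤N = refl
  below-inject (suc m) m<N = sym (trans (reverse-tabulate-suc (λ i → Fin.inject≤ i m<N)) (cong₂ _∷_
    (Fin.toℕ-injective (trans (Fin.toℕ-inject≤ (Fin.fromℕ m) m<N) (trans (Fin.toℕ-fromℕ m) (sym (Fin.toℕ-fromℕ< m<N)))))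
    (trans (cong reverse (tabulate-cong λ i → Fin.toℕ-injective (trans (Fin.toℕ-inject≤ (inject₁ i) m<N)
        (trans (Fin.toℕ-inject₁ i) (sym (Fin.toℕ-inject≤ i (ℕ.<⇒≤ m<N)))))))
      (sym (below-inject m (ℕ.<⇒≤ m<N))))))

  -- At level `N` no vertex is forced to be fixed, so the levels are exactly the cyclic partitions.
  -- Two lists without repetition and with the same members are permutations of each other and have
  -- equal length.
  c-coefficient : ∀ k → c D k ≡ coefficient (reverse (tabulate (length ∘ targets D))) k
  c-coefficient k = trans
    (↭-length (∼bag⇒↭ (unique∧set⇒bag (Unique.filter⁺ (isCyclicPartition? D k) (allVecs-unique N N)) (levels-unique N ℕ.≤-refl k)
      (mk⇔ (λ σ∈ → let _ , perm , cyc , av = ∈-filter⁻ (isCyclicPartition? D k) {xs = allVecs N N} σ∈ in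
              ∈-levels⁺ N ℕ.≤-refl (level perm (λ x N≤x → contradiction N≤x (ℕ.<⇒≱ (Fin.toℕ<n x))) cyc (λ i _ → av i)))
           (λ σ∈ → let open Level (∈-levels⁻ N ℕ.≤-refl σ∈) in
              ∈-filter⁺ (isCyclicPartition? D k) (∈-allVecs _) (permutation , cycles , λ i → avoids i (Fin.toℕ<n i)))))))
    (trans (length-levels N ℕ.≤-refl 0 k (ℕ.+-identityʳ N)) (cong (λ ds → coefficient ds k)
      (trans (cong (map (length ∘ targets D)) (below-inject N ℕ.≤-refl))
        (trans (reverse-map (length ∘ targets D) (tabulate inj))
          (cong reverse (trans (map-tabulate inj (length ∘ targets D))
            (tabulate-cong λ i → cong (length ∘ targets D) (Fin.toℕ-injective (Fin.toℕ-inject≤ i ℕ.≤-refl)))))))))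
    where
    inj : Fin N → Fin N
    inj i = Fin.inject≤ i ℕ.≤-refl

-- Counting non-neighbours in H and G

heights : Word → List ℕ
heights []      = []
heights (V ∷ w) = heights w
heights (U ∷ w) = #V w ∷ heights w

ᵈ-irreflexive : ∀ G {i} → ¬ Digraph._⟶_ (G ᵈ) i i
ᵈ-irreflexive G (i<i , _) = ℕ.<-irrefl refl i<i

nonNeighbours : (G : Graph) → Fin (Graph.order G) → ℕ
nonNeighbours G = length ∘ targets (G ᵈ)

-- Largest label first, to match the order of `heights`. Through `targets` only non-neighbours with
-- a smaller label are counted.
nonNeighbourCounts : Graph → List ℕ
nonNeighbourCounts G = reverse (tabulate (nonNeighbours G))

length-filter-map : ∀ {a b p} {A : Set a} {B : Set b} {P : Pred B p} (P? : Decidable P) (f : A → B) xs →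
  length (filter P? (map f xs)) ≡ length (filter (P? ∘ f) xs)
length-filter-map P? f [] = refl
length-filter-map P? f (x ∷ xs) with P? (f x)
... | yes _ = cong suc (length-filter-map P? f xs)
... | no  _ = length-filter-map P? f xs

tabulate-++ : ∀ {a} {A : Set a} m {n} (f : Fin (m + n) → A) →
  tabulate f ≡ tabulate (λ i → f (i ↑ˡ n)) ++ tabulate (λ i → f (m ↑ʳ i))
tabulate-++ zero    f = refl
tabulate-++ (suc m) f = cong (f zero ∷_) (tabulate-++ m (f ∘ suc))

allFin-++ : ∀ m n → allFin (m + n) ≡ map (_↑ˡ n) (allFin m) ++ map (m ↑ʳ_) (allFin n)
allFin-++ m n = trans (tabulate-++ m id) (sym (cong₂ _++_ (map-tabulate id (_↑ˡ n)) (map-tabulate id (m ↑ʳ_))))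

length-filter-++ : ∀ {a p} {A : Set a} {P : Pred A p} (P? : Decidable P) xs ys →
  length (filter P? (xs ++ ys)) ≡ length (filter P? xs) + length (filter P? ys)
length-filter-++ P? xs ys = trans (cong length (filter-++ P? xs ys)) (length-++ (filter P? xs))

module _ (G₁ G₂ : Graph) where
  private
    module G₁ = Graph G₁
    module G₂ = Graph G₂
    module G  = Graph (G₁ ⊎ᴳ G₂)
    a = G₁.order
    b = G₂.order

  nonNeighbours-⊎ˡ : ∀ i → nonNeighbours (G₁ ⊎ᴳ G₂) (i ↑ˡ b) ≡ nonNeighbours G₁ i
  nonNeighbours-⊎ˡ i = begin
    length (filter P? (allFin (a + b)))                                   ≡⟨ cong (length ∘ filter P?) (allFin-++ a b) ⟩
    length (filter P? (map (_↑ˡ b) (allFin a) ++ map (a ↑ʳ_) (allFin b)))  ≡⟨ length-filter-++ P? (map (_↑ˡ b) (allFin a)) _ ⟩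
    length (filter P? (map (_↑ˡ b) (allFin a))) + length (filter P? (map (a ↑ʳ_) (allFin b)))
      ≡⟨ cong₂ _+_ (trans (length-filter-map P? (_↑ˡ b) (allFin a)) (length-filter-cong (P? ∘ (_↑ˡ b)) (target? (G₁ ᵈ) i) (allFin a) λ _ → to , from))
           (trans (length-filter-map P? (a ↑ʳ_) (allFin b)) (cong length (filter-none (P? ∘ (a ↑ʳ_)) (All.universal right (allFin b))))) ⟩
    nonNeighbours G₁ i + 0 ≡⟨ ℕ.+-identityʳ _ ⟩
    nonNeighbours G₁ i ∎
    where
    open ≡-Reasoning
    P? = target? ((G₁ ⊎ᴳ G₂) ᵈ) (i ↑ˡ b)
    adj : ∀ {j} → G.Adjacent (i ↑ˡ b) (j ↑ˡ b) → G₁.Adjacent i j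
    adj {j} e rewrite Fin.splitAt-↑ˡ a i b | Fin.splitAt-↑ˡ a j b with inj₁ e ← e = e
    adj⁺ : ∀ {j} → G₁.Adjacent i j → G.Adjacent (i ↑ˡ b) (j ↑ˡ b)
    adj⁺ {j} e rewrite Fin.splitAt-↑ˡ a i b | Fin.splitAt-↑ˡ a j b = inj₁ e
    lt : ∀ {j} → (j ↑ˡ b) Fin.< (i ↑ˡ b) → j Fin.< i
    lt {j} = subst₂ _<_ (Fin.toℕ-↑ˡ j b) (Fin.toℕ-↑ˡ i b)
    lt⁺ : ∀ {j} → j Fin.< i → (j ↑ˡ b) Fin.< (i ↑ˡ b)
    lt⁺ {j} = subst₂ _<_ (sym (Fin.toℕ-↑ˡ j b)) (sym (Fin.toℕ-↑ˡ i b))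
    to : ∀ {j} → (j ↑ˡ b) Fin.< (i ↑ˡ b) × ¬ Digraph._⟶_ ((G₁ ⊎ᴳ G₂) ᵈ) (i ↑ˡ b) (j ↑ˡ b) →
      j Fin.< i × ¬ Digraph._⟶_ (G₁ ᵈ) i j
    to (j<i , ¬e) = lt j<i , λ (_ , e) → ¬e (j<i , G.symmetric (adj⁺ (G₁.symmetric e)))
    from : ∀ {j} → j Fin.< i × ¬ Digraph._⟶_ (G₁ ᵈ) i j →
      (j ↑ˡ b) Fin.< (i ↑ˡ b) × ¬ Digraph._⟶_ ((G₁ ⊎ᴳ G₂) ᵈ) (i ↑ˡ b) (j ↑ˡ b)
    from (j<i , ¬e) = lt⁺ j<i , λ (_ , e) → ¬e (j<i , G₁.symmetric (adj (G.symmetric e)))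
    right : ∀ j → ¬ ((a ↑ʳ j) Fin.< (i ↑ˡ b) × _)
    right j (lt , _) = ℕ.<⇒≱ (subst₂ _<_ (Fin.toℕ-↑ʳ a j) (Fin.toℕ-↑ˡ i b) lt)
      (ℕ.≤-trans (ℕ.<⇒≤ (Fin.toℕ<n i)) (ℕ.m≤m+n a (toℕ j)))

  nonNeighbours-⊎ʳ : ∀ i → nonNeighbours (G₁ ⊎ᴳ G₂) (a ↑ʳ i) ≡ a + nonNeighbours G₂ i
  nonNeighbours-⊎ʳ i = begin
    length (filter P? (allFin (a + b)))                                   ≡⟨ cong (length ∘ filter P?) (allFin-++ a b) ⟩
    length (filter P? (map (_↑ˡ b) (allFin a) ++ map (a ↑ʳ_) (allFin b)))  ≡⟨ length-filter-++ P? (map (_↑ˡ b) (allFin a)) _ ⟩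
    length (filter P? (map (_↑ˡ b) (allFin a))) + length (filter P? (map (a ↑ʳ_) (allFin b)))
      ≡⟨ cong₂ _+_ (trans (length-filter-map P? (_↑ˡ b) (allFin a)) (trans (cong length (filter-all (P? ∘ (_↑ˡ b)) (All.universal left (allFin a)))) (length-tabulate id)))
           (trans (length-filter-map P? (a ↑ʳ_) (allFin b)) (length-filter-cong (P? ∘ (a ↑ʳ_)) (target? (G₂ ᵈ) i) (allFin b) λ _ → to , from)) ⟩
    a + nonNeighbours G₂ i ∎
    where
    open ≡-Reasoning
    P? = target? ((G₁ ⊎ᴳ G₂) ᵈ) (a ↑ʳ i)
    adj : ∀ {j} → G.Adjacent (a ↑ʳ j) (a ↑ʳ i) → G₂.Adjacent j i
    adj {j} e rewrite Fin.splitAt-↑ʳ a b i | Fin.splitAt-↑ʳ a b j with inj₂ e ← e = e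
    adj⁺ : ∀ {j} → G₂.Adjacent j i → G.Adjacent (a ↑ʳ j) (a ↑ʳ i)
    adj⁺ {j} e rewrite Fin.splitAt-↑ʳ a b i | Fin.splitAt-↑ʳ a b j = inj₂ e
    lt : ∀ {j} → (a ↑ʳ j) Fin.< (a ↑ʳ i) → j Fin.< i
    lt {j} = ℕ.+-cancelˡ-< a _ _ ∘ subst₂ _<_ (Fin.toℕ-↑ʳ a j) (Fin.toℕ-↑ʳ a i)
    lt⁺ : ∀ {j} → j Fin.< i → (a ↑ʳ j) Fin.< (a ↑ʳ i)
    lt⁺ {j} = subst₂ _<_ (sym (Fin.toℕ-↑ʳ a j)) (sym (Fin.toℕ-↑ʳ a i)) ∘ ℕ.+-monoʳ-< a
    to : ∀ {j} → (a ↑ʳ j) Fin.< (a ↑ʳ i) × ¬ Digraph._⟶_ ((G₁ ⊎ᴳ G₂) ᵈ) (a ↑ʳ i) (a ↑ʳ j) →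
      j Fin.< i × ¬ Digraph._⟶_ (G₂ ᵈ) i j
    to (j<i , ¬e) = lt j<i , λ (_ , e) → ¬e (j<i , adj⁺ e)
    from : ∀ {j} → j Fin.< i × ¬ Digraph._⟶_ (G₂ ᵈ) i j →
      (a ↑ʳ j) Fin.< (a ↑ʳ i) × ¬ Digraph._⟶_ ((G₁ ⊎ᴳ G₂) ᵈ) (a ↑ʳ i) (a ↑ʳ j)
    from (j<i , ¬e) = lt⁺ j<i , λ (_ , e) → ¬e (j<i , adj e)
    left : ∀ j → (j ↑ˡ b) Fin.< (a ↑ʳ i) × ¬ Digraph._⟶_ ((G₁ ⊎ᴳ G₂) ᵈ) (a ↑ʳ i) (j ↑ˡ b)
    left j = subst₂ _<_ (sym (Fin.toℕ-↑ˡ j b)) (sym (Fin.toℕ-↑ʳ a i)) (ℕ.≤-trans (Fin.toℕ<n j) (ℕ.m≤m+n a (toℕ i)))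
      , λ (_ , e) → nonadj e
      where
      nonadj : ¬ G.Adjacent (j ↑ˡ b) (a ↑ʳ i)
      nonadj e rewrite Fin.splitAt-↑ʳ a b i | Fin.splitAt-↑ˡ a j b with () ← e

  -- Each of the `a` vertices of `G₁` precedes and is not adjacent to any vertex of `G₂`, which adds
  -- `a` there; the vertices of `G₂` come too late to count for `G₁`.
  nonNeighbourCounts-⊎ : nonNeighbourCounts (G₁ ⊎ᴳ G₂) ≡ map (a +_) (nonNeighbourCounts G₂) ++ nonNeighbourCounts G₁
  nonNeighbourCounts-⊎ = begin
    reverse (tabulate (nonNeighbours (G₁ ⊎ᴳ G₂)))  ≡⟨ cong reverse (tabulate-++ a (nonNeighbours (G₁ ⊎ᴳ G₂))) ⟩
    reverse (tabulate (λ i → nonNeighbours (G₁ ⊎ᴳ G₂) (i ↑ˡ b)) ++ tabulate (λ i → nonNeighbours (G₁ ⊎ᴳ G₂) (a ↑ʳ i)))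
      ≡⟨ cong₂ (λ xs ys → reverse (xs ++ ys)) (tabulate-cong nonNeighbours-⊎ˡ) (tabulate-cong nonNeighbours-⊎ʳ) ⟩
    reverse (tabulate (nonNeighbours G₁) ++ tabulate (λ i → a + nonNeighbours G₂ i)) ≡⟨ reverse-++ (tabulate (nonNeighbours G₁)) _ ⟩
    reverse (tabulate (λ i → a + nonNeighbours G₂ i)) ++ nonNeighbourCounts G₁
      ≡⟨ cong (λ xs → reverse xs ++ nonNeighbourCounts G₁) (map-tabulate (nonNeighbours G₂) (a +_)) ⟨
    reverse (map (a +_) (tabulate (nonNeighbours G₂))) ++ nonNeighbourCounts G₁
      ≡⟨ cong (_++ nonNeighbourCounts G₁) (reverse-map (a +_) (tabulate (nonNeighbours G₂))) ⟨
    map (a +_) (nonNeighbourCounts G₂) ++ nonNeighbourCounts G₁ ∎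
    where open ≡-Reasoning

module _ (G : Graph) where
  open Graph G using (order; Adjacent; symmetric)

  nonNeighbours-cone-zero : nonNeighbours (cone G) zero ≡ 0
  nonNeighbours-cone-zero = cong length (filter-none (target? ((cone G) ᵈ) zero) (All.universal (λ _ ()) (allFin (suc order))))

  nonNeighbours-cone-suc : ∀ i → nonNeighbours (cone G) (suc i) ≡ nonNeighbours G i
  nonNeighbours-cone-suc i = begin
    length (filter P? (zero ∷ tabulate suc))      ≡⟨ cong length (filter-reject P? {x = zero} {xs = tabulate suc} λ (0<i , ¬e) → ¬e (0<i , _)) ⟩
    length (filter P? (tabulate suc))             ≡⟨ cong (length ∘ filter P?) (map-tabulate id suc) ⟨
    length (filter P? (map suc (allFin order)))   ≡⟨ length-filter-map P? suc (allFin order) ⟩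
    length (filter (P? ∘ suc) (allFin order))     ≡⟨ length-filter-cong (P? ∘ suc) (target? (G ᵈ) i) (allFin order) (λ _ → to , from) ⟩
    nonNeighbours G i                             ∎
    where
    open ≡-Reasoning
    P? = target? ((cone G) ᵈ) (suc i)
    to : ∀ {j} → suc j Fin.< suc i × ¬ (suc j Fin.< suc i × Adjacent j i) → j Fin.< i × ¬ (j Fin.< i × Adjacent j i)
    to (j<i , ¬e) = ℕ.s<s⁻¹ j<i , λ (_ , e) → ¬e (j<i , e)
    from : ∀ {j} → j Fin.< i × ¬ (j Fin.< i × Adjacent j i) → suc j Fin.< suc i × ¬ (suc j Fin.< suc i × Adjacent j i)
    from (j<i , ¬e) = ℕ.s<s j<i , λ (_ , e) → ¬e (j<i , e)

  -- The new vertex has no smaller one, which gives the 0; being adjacent to all others, it leaves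
  -- their counts unchanged.
  nonNeighbourCounts-cone : nonNeighbourCounts (cone G) ≡ nonNeighbourCounts G ∷ʳ 0
  nonNeighbourCounts-cone = begin
    reverse (nonNeighbours (cone G) zero ∷ tabulate (nonNeighbours (cone G) ∘ suc))
      ≡⟨ cong₂ (λ x xs → reverse (x ∷ xs)) nonNeighbours-cone-zero (tabulate-cong nonNeighbours-cone-suc) ⟩
    reverse (0 ∷ tabulate (nonNeighbours G)) ≡⟨ unfold-reverse 0 (tabulate (nonNeighbours G)) ⟩
    nonNeighbourCounts G ∷ʳ 0 ∎
    where open ≡-Reasoning

-- Heights of words and the graph G_w.

#V-++ : ∀ w₁ w₂ → #V (w₁ ++ w₂) ≡ #V w₂ + #V w₁
#V-++ []       w₂ = sym (ℕ.+-identityʳ _)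
#V-++ (V ∷ w₁) w₂ = trans (cong suc (#V-++ w₁ w₂)) (sym (ℕ.+-suc (#V w₂) (#V w₁)))
#V-++ (U ∷ w₁) w₂ = #V-++ w₁ w₂

-- All V's of `w₂` lie to the right of every U of `w₁`.
heights-++ : ∀ w₁ w₂ → heights (w₁ ++ w₂) ≡ map (#V w₂ +_) (heights w₁) ++ heights w₂
heights-++ []       w₂ = refl
heights-++ (V ∷ w₁) w₂ = heights-++ w₁ w₂
heights-++ (U ∷ w₁) w₂ = cong₂ _∷_ (#V-++ w₁ w₂) (heights-++ w₁ w₂)

-- The order is expressed in V's because this is the shift that appears in `heights-++`.
order-graphᴵ : ∀ {w} (d : Irreducible w) → Graph.order (graphᴵ d) ≡ #V w
order-graph  : ∀ {w} (f : Factorisation w) → Graph.order (graph f) ≡ #V w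
order-graphᴵ VU             = refl
order-graphᴵ (wrap {w} _ f) = cong suc (trans (order-graph f) (sym (#V-++ w (U ∷ []))))
order-graph []                    = refl
order-graph (_∷_ {w₁} {w₂} d f) = trans (cong₂ _+_ (order-graph f) (order-graphᴵ d)) (sym (#V-++ w₁ w₂))

-- Heights obey the recursion of the graph: the outer V changes no height, the outer U has no V
-- after it and contributes the final 0, and juxtaposition shifts the heights of the left word as
-- the disjoint union shifts counts.
nonNeighbourCounts-graphᴵ : ∀ {w} (d : Irreducible w) → nonNeighbourCounts (graphᴵ d) ≡ heights w
nonNeighbourCounts-graph  : ∀ {w} (f : Factorisation w) → nonNeighbourCounts (graph f) ≡ heights w
nonNeighbourCounts-graphᴵ VU = refl
nonNeighbourCounts-graphᴵ (wrap {w} _ f) = begin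
  nonNeighbourCounts (cone (graph f))      ≡⟨ nonNeighbourCounts-cone (graph f) ⟩
  nonNeighbourCounts (graph f) ∷ʳ 0        ≡⟨ cong (_∷ʳ 0) (nonNeighbourCounts-graph f) ⟩
  heights w ∷ʳ 0                           ≡⟨ cong (_∷ʳ 0) (map-id (heights w)) ⟨
  map (0 +_) (heights w) ∷ʳ 0              ≡⟨ heights-++ w (U ∷ []) ⟨
  heights (w ∷ʳ U)                         ∎
  where open ≡-Reasoning
nonNeighbourCounts-graph [] = refl
nonNeighbourCounts-graph (_∷_ {w₁} {w₂} d f) = begin
  nonNeighbourCounts (graph f ⊎ᴳ graphᴵ d)  ≡⟨ nonNeighbourCounts-⊎ (graph f) (graphᴵ d) ⟩
  map (Graph.order (graph f) +_) (nonNeighbourCounts (graphᴵ d)) ++ nonNeighbourCounts (graph f)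
    ≡⟨ cong₂ _++_ (cong₂ (λ m → map (m +_)) (order-graph f) (nonNeighbourCounts-graphᴵ d)) (nonNeighbourCounts-graph f) ⟩
  map (#V w₂ +_) (heights w₁) ++ heights w₂ ≡⟨ heights-++ w₁ w₂ ⟨
  heights (w₁ ++ w₂)                        ∎
  where open ≡-Reasoning

-- The board and the graph H_w.

length-filter-< : ∀ {n h} → h ≤ n → length (filter (λ j → toℕ j ℕ.<? h) (allFin n)) ≡ h
length-filter-< {n} {h} h≤n with r , refl ← ℕ.m≤n⇒∃[o]m+o≡n h≤n = begin
  length (filter P? (allFin (h + r)))  ≡⟨ cong (length ∘ filter P?) (allFin-++ h r) ⟩
  length (filter P? (map (_↑ˡ r) (allFin h) ++ map (h ↑ʳ_) (allFin r))) ≡⟨ length-filter-++ P? (map (_↑ˡ r) (allFin h)) _ ⟩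
  length (filter P? (map (_↑ˡ r) (allFin h))) + length (filter P? (map (h ↑ʳ_) (allFin r)))
    ≡⟨ cong₂ _+_
         (trans (length-filter-map P? (_↑ˡ r) (allFin h)) (trans (cong length (filter-all (P? ∘ (_↑ˡ r))
           (All.universal (λ j → subst (_< h) (sym (Fin.toℕ-↑ˡ j r)) (Fin.toℕ<n j)) (allFin h)))) (length-tabulate id)))
         (trans (length-filter-map P? (h ↑ʳ_) (allFin r)) (cong length (filter-none (P? ∘ (h ↑ʳ_))
           (All.universal (λ j lt → ℕ.<⇒≱ (subst (_< h) (Fin.toℕ-↑ʳ h j) lt) (ℕ.m≤m+n h (toℕ j))) (allFin r))))) ⟩
  h + 0 ≡⟨ ℕ.+-identityʳ h ⟩
  h ∎
  where
  open ≡-Reasoning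
  P? = λ j → toℕ j ℕ.<? h

reverse-tabulate-opposite : ∀ {a} {A : Set a} {n} (g : Fin n → A) → reverse (tabulate (g ∘ opposite)) ≡ tabulate g
reverse-tabulate-opposite {n = zero}  g = refl
reverse-tabulate-opposite {n = suc n} g = trans (reverse-tabulate-suc (g ∘ opposite)) (cong₂ _∷_
  (cong g (Fin.toℕ-injective (trans (Fin.opposite-prop (Fin.fromℕ n)) (trans (cong (n ∸_) (Fin.toℕ-fromℕ n)) (ℕ.n∸n≡0 n)))))
  (trans (cong reverse (tabulate-cong λ i → cong g (opposite-inject₁ i))) (reverse-tabulate-opposite (g ∘ suc))))
  where
  opposite-inject₁ : ∀ {n} (i : Fin n) → opposite (inject₁ i) ≡ suc (opposite i)
  opposite-inject₁ zero    = refl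
  opposite-inject₁ (suc i) = cong inject₁ (opposite-inject₁ i)

tabulate-V-counts : ∀ w → tabulate (lookup (V-counts w)) ≡ heights w
tabulate-V-counts []      = refl
tabulate-V-counts (V ∷ w) = tabulate-V-counts w
tabulate-V-counts (U ∷ w) = cong (#V w ∷_) (tabulate-V-counts w)

SuffixBounded : Word → Set
SuffixBounded w = ∀ p s → w ≡ p ++ s → #V s ≤ #U s

#U-++ : ∀ w₁ w₂ → #U (w₁ ++ w₂) ≡ #U w₂ + #U w₁
#U-++ []       w₂ = sym (ℕ.+-identityʳ _)
#U-++ (U ∷ w₁) w₂ = trans (cong suc (#U-++ w₁ w₂)) (sym (ℕ.+-suc (#U w₂) (#U w₁)))
#U-++ (V ∷ w₁) w₂ = #U-++ w₁ w₂

-- The totals of V's and U's agree, so a surplus of V's in a prefix is a surplus of U's in the rest.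
dyck-suffix : ∀ {w} → IsDyck w → SuffixBounded w
dyck-suffix (#V≡#U , prefix) p s refl = ℕ.+-cancelʳ-≤ (#U p) (#V s) (#U s)
  (ℕ.≤-trans (ℕ.+-monoʳ-≤ (#V s) (prefix p s refl))
    (ℕ.≤-reflexive (trans (sym (#V-++ p s)) (trans #V≡#U (#U-++ p s)))))

-- The right-hand side is the number of U's after the chosen one, and the suffix there has at most
-- as many V's.
V-counts-bound : ∀ w → SuffixBounded w → ∀ r → lookup (V-counts w) r ≤ #U w ∸ suc (toℕ r)
V-counts-bound (V ∷ w) bounded r       = V-counts-bound w (λ p s eq → bounded (V ∷ p) s (cong (V ∷_) eq)) r
V-counts-bound (U ∷ w) bounded zero    = bounded (U ∷ []) w refl
V-counts-bound (U ∷ w) bounded (suc r) = V-counts-bound w (λ p s eq → bounded (U ∷ p) s (cong (U ∷_) eq)) r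

columnHeight-bound : ∀ {w} → IsDyck w → ∀ i → columnHeight w i ≤ toℕ i
columnHeight-bound {w} dyck i = subst (columnHeight w i ≤_)
  (trans (sym (Fin.opposite-prop (opposite i))) (cong toℕ (Fin.opposite-involutive i)))
  (V-counts-bound w (dyck-suffix dyck) (opposite i))

-- The non-neighbours below `i` are the cells of column `i` in rows `j < i`. By the Dyck condition
-- the whole column lies in these rows, so its full height is counted.
nonNeighbours-H : ∀ {w} → IsDyck w → ∀ i → nonNeighbours (H w) i ≡ columnHeight w i
nonNeighbours-H {w} dyck i = trans
  (length-filter-cong (target? ((H w) ᵈ) i) (board? w i) (allFin (#U w)) λ _ →
    -- Non-adjacency negates a negated board condition; decidability removes the double negation.
    (λ (j<i , ¬e) → decidable-stable (board? w i _) λ ¬b → ¬e (j<i , inj₂ (j<i , ¬b))) ,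
    (λ b → ℕ.<-≤-trans b (columnHeight-bound dyck i) , λ where
      (j<i , inj₁ (i<j , _)) → ℕ.<-asym j<i i<j
      (_ , inj₂ (_ , ¬b))    → ¬b b))
  (length-filter-< (ℕ.≤-trans (columnHeight-bound dyck i) (ℕ.<⇒≤ (Fin.toℕ<n i))))

nonNeighbourCounts-H : ∀ {w} → IsDyck w → nonNeighbourCounts (H w) ≡ heights w
nonNeighbourCounts-H {w} dyck = trans (cong reverse (tabulate-cong (nonNeighbours-H dyck)))
  (trans (reverse-tabulate-opposite (lookup (V-counts w))) (tabulate-V-counts w))

-- Normal ordering

length-heights : ∀ w → length (heights w) ≡ #U w
length-heights []      = refl
length-heights (V ∷ w) = length-heights w
length-heights (U ∷ w) = cong suc (length-heights w)

coefficient-beyond : ∀ ds {k} → length ds < k → coefficient ds k ≡ 0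
coefficient-beyond []       {suc k} _ = refl
coefficient-beyond (d ∷ ds) {suc k} lt
  rewrite coefficient-beyond ds (ℕ.s<s⁻¹ lt) | coefficient-beyond ds (ℕ.<-trans (ℕ.n<1+n _) lt) = ℕ.*-zeroʳ d

module _ {a ℓ} (K : CommutativeRing a ℓ) where
  private module K = CommutativeRing K
  open NormalOrder K renaming (_+_ to _⊕_; _*_ to _⊗_)
  private
    module A = Ring algebra
    module K× = Algebra.Properties.Semiring.Mult K.semiring
  open Algebra.Properties.Semiring.Exp A.semiring using (_^_)
  open Algebra.Properties.Semiring.Sum A.semiring
    using (sum; sum-cong-≋; sum-cong-≗; sum-init-last; *-distribˡ-sum; ∑-distrib-+)
  open import Relation.Binary.Reasoning.Setoid A.setoid

  private
    ι : ℕ → Term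
    ι m = scalar (fromℕ m)

    ι-+ : ∀ m n → ι (m + n) ≈ ι m ⊕ ι n
    ι-+ m n = ≈-trans (scalar-cong (K×.×-homo-+ K.1# m n)) (scalar-+ _ _)

    ι-* : ∀ m n → ι (m * n) ≈ ι m ⊗ ι n
    ι-* m n = ≈-trans (scalar-cong (K×.×1-homo-* m n)) (scalar-* _ _)

    U*V^ : ∀ m → gen U ⊗ gen V ^ m ≈ gen V ^ m ⊗ (gen U ⊕ ι m)
    U*V^ zero = ≈-trans (*-identityʳ _) (≈-sym (≈-trans (*-identityˡ _) (A.+-identityʳ _)))
    U*V^ (suc m) = begin
      gen U ⊗ (gen V ⊗ vᵐ)                    ≈⟨ *-assoc _ _ _ ⟨
      gen U ⊗ gen V ⊗ vᵐ                      ≈⟨ A.*-congʳ UV≈VU+V ⟩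
      (gen V ⊗ gen U ⊕ gen V) ⊗ vᵐ            ≈⟨ distribʳ _ _ _ ⟩
      gen V ⊗ gen U ⊗ vᵐ ⊕ gen V ⊗ vᵐ         ≈⟨ A.+-congʳ (≈-trans (*-assoc _ _ _) (A.*-congˡ (U*V^ m))) ⟩
      gen V ⊗ (vᵐ ⊗ (gen U ⊕ ι m)) ⊕ gen V ⊗ vᵐ ≈⟨ +-cong (*-assoc _ _ _) (*-identityʳ _) ⟨
      gen V ⊗ vᵐ ⊗ (gen U ⊕ ι m) ⊕ gen V ⊗ vᵐ ⊗ scalar K.1# ≈⟨ distribˡ _ _ _ ⟨
      gen V ⊗ vᵐ ⊗ (gen U ⊕ ι m ⊕ scalar K.1#) ≈⟨ A.*-congˡ (≈-trans (+-assoc _ _ _) (A.+-congˡ (+-comm _ _))) ⟩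
      gen V ⊗ vᵐ ⊗ (gen U ⊕ (scalar K.1# ⊕ ι m)) ≈⟨ A.*-congˡ (A.+-congˡ (scalar-+ _ _)) ⟨
      gen V ⊗ vᵐ ⊗ (gen U ⊕ ι (suc m))        ∎
      where vᵐ = gen V ^ m

    -- Here `n` is the top degree, so there are `n + 1` terms; a coefficient sequence on all of ℕ
    -- can be cut at any degree.
    poly : (ℕ → ℕ) → ℕ → Term
    poly a n = sum {suc n} (λ k → ι (a (toℕ k)) ⊗ gen U ^ toℕ k)

    poly-extend : ∀ a n → a (suc n) ≡ 0 → poly a n ≈ poly a (suc n)
    poly-extend a n eq = ≈-sym (begin
      poly a (suc n)  ≈⟨ sum-init-last (λ k → ι (a (toℕ k)) ⊗ gen U ^ toℕ k) ⟩
      sum {suc n} (λ k → ι (a (toℕ (inject₁ k))) ⊗ gen U ^ toℕ (inject₁ k)) ⊕ ι (a (toℕ (Fin.fromℕ (suc n)))) ⊗ gen U ^ toℕ (Fin.fromℕ (suc n))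
        ≈⟨ +-cong (A.reflexive (sum-cong-≗ {suc n} (λ k → cong (λ i → ι (a i) ⊗ gen U ^ i) (Fin.toℕ-inject₁ k))))
             (≈-trans (A.*-congʳ (A.reflexive (cong ι (trans (cong a (Fin.toℕ-fromℕ (suc n))) eq)))) (A.zeroˡ _)) ⟩
      poly a n ⊕ scalar K.0#  ≈⟨ A.+-identityʳ _ ⟩
      poly a n ∎)

    -- The product with `gen U` shifts the coefficients and the product with `ι d` scales them,
    -- which are the two summands in the recursion of `coefficient`.
    poly-step : ∀ d ds n → length ds ≡ n →
      (gen U ⊕ ι d) ⊗ poly (coefficient ds) n ≈ poly (coefficient (d ∷ ds)) (suc n)
    poly-step d ds n len = begin
      (gen U ⊕ ι d) ⊗ p n                ≈⟨ distribʳ _ _ _ ⟩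
      -- The scaled polynomial is padded by a zero term of degree `suc n` to reach the length of the
      -- shifted one.
      gen U ⊗ p n ⊕ ι d ⊗ p n            ≈⟨ +-cong U*p (A.*-congˡ (poly-extend (coefficient ds) n (coefficient-beyond ds (ℕ.≤-reflexive (cong suc len))))) ⟩
      sum {suc n} (λ k → ι (coefficient ds (toℕ k)) ⊗ gen U ^ suc (toℕ k)) ⊕ ι d ⊗ p (suc n)
        ≈⟨ A.+-congˡ (*-distribˡ-sum {suc (suc n)} (ι d) (λ k → ι (coefficient ds (toℕ k)) ⊗ gen U ^ toℕ k)) ⟩
      S ⊕ (ι d ⊗ t 0 ⊕ sum {suc n} (λ k → ι d ⊗ t (suc (toℕ k))))
        -- The shifted sum has no constant term, so that of the scaled sum is moved to the front and
        -- the other terms are paired by degree.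
        ≈⟨ ≈-trans (≈-sym (+-assoc _ _ _)) (≈-trans (A.+-congʳ (+-comm _ _)) (+-assoc _ _ _)) ⟩
      ι d ⊗ t 0 ⊕ (S ⊕ sum {suc n} (λ k → ι d ⊗ t (suc (toℕ k))))
        ≈⟨ +-cong (merge (coefficient ds 0) 0)
             (≈-sym (∑-distrib-+ {suc n} (λ k → ι (coefficient ds (toℕ k)) ⊗ gen U ^ suc (toℕ k)) (λ k → ι d ⊗ t (suc (toℕ k))))) ⟩
      ι (d * coefficient ds 0) ⊗ gen U ^ 0 ⊕ sum {suc n} (λ k → ι (coefficient ds (toℕ k)) ⊗ gen U ^ suc (toℕ k) ⊕ ι d ⊗ t (suc (toℕ k)))
        ≈⟨ A.+-congˡ (sum-cong-≋ {suc n} λ k → ≈-trans (A.+-congˡ (merge (coefficient ds (suc (toℕ k))) (suc (toℕ k))))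
             (≈-trans (≈-sym (distribʳ _ _ _)) (A.*-congʳ (≈-sym (ι-+ (coefficient ds (toℕ k)) (d * coefficient ds (suc (toℕ k)))))))) ⟩
      poly (coefficient (d ∷ ds)) (suc n) ∎
      where
      p = poly (coefficient ds)
      t : ℕ → Term
      t k = ι (coefficient ds k) ⊗ gen U ^ k
      S = sum {suc n} (λ k → ι (coefficient ds (toℕ k)) ⊗ gen U ^ suc (toℕ k))
      merge : ∀ b k → ι d ⊗ (ι b ⊗ gen U ^ k) ≈ ι (d * b) ⊗ gen U ^ k
      merge b k = ≈-trans (≈-sym (*-assoc _ _ _)) (A.*-congʳ (≈-sym (ι-* d b)))
      U*p : gen U ⊗ p n ≈ S
      U*p = ≈-trans (*-distribˡ-sum {suc n} (gen U) (λ k → t (toℕ k))) (sum-cong-≋ {suc n} λ k →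
        ≈-trans (≈-sym (*-assoc _ _ _)) (≈-trans (A.*-congʳ (≈-sym (central (fromℕ (coefficient ds (toℕ k))) (gen U)))) (*-assoc _ _ (gen U ^ toℕ k))))

  heights-normalOrder : ∀ w → IsNormalOrder w (λ k → fromℕ (coefficient (heights w) (toℕ k)))
  heights-normalOrder [] = ≈-sym (begin
    scalar K.1# ⊗ (ι 1 ⊗ scalar K.1# ⊕ scalar K.0#)  ≈⟨ *-identityˡ _ ⟩
    ι 1 ⊗ scalar K.1# ⊕ scalar K.0#  ≈⟨ A.+-identityʳ _ ⟩
    ι 1 ⊗ scalar K.1#                ≈⟨ *-identityʳ _ ⟩
    ι 1                              ≈⟨ scalar-cong (K.+-identityʳ _) ⟩
    scalar K.1#                      ∎)
  heights-normalOrder (V ∷ w) = ≈-trans (A.*-congˡ (heights-normalOrder w)) (≈-sym (*-assoc _ _ _))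
  heights-normalOrder (U ∷ w) = begin
    gen U ⊗ ⟦ w ⟧                              ≈⟨ A.*-congˡ (heights-normalOrder w) ⟩
    gen U ⊗ (vᵐ ⊗ p)                           ≈⟨ *-assoc _ _ _ ⟨
    gen U ⊗ vᵐ ⊗ p                             ≈⟨ A.*-congʳ (U*V^ (#V w)) ⟩
    vᵐ ⊗ (gen U ⊕ ι (#V w)) ⊗ p                ≈⟨ *-assoc _ _ _ ⟩
    vᵐ ⊗ ((gen U ⊕ ι (#V w)) ⊗ p)              ≈⟨ A.*-congˡ (poly-step (#V w) (heights w) (#U w) (length-heights w)) ⟩
    vᵐ ⊗ poly (coefficient (heights (U ∷ w))) (suc (#U w))  ∎
    where
    vᵐ = gen V ^ #V w
    p  = poly (coefficient (heights w)) (#U w)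

  -- Uniqueness of the normal order expansion identifies its coefficients with those exhibited in
  -- `heights-normalOrder`.
  normalOrder-coefficient : ∀ w k → [ w , k ] K.≈ fromℕ (coefficient (heights w) (toℕ k))
  normalOrder-coefficient w = proj₂ (proj₂ (normalOrder w)) (heights-normalOrder w)

theorem8 : ∀ {a ℓ} (K : CommutativeRing a ℓ) (w : Word) (dyck : IsDyck w) (k : Fin (suc (#U w))) →
    let open CommutativeRing K using (_≈_)
        open NormalOrder K using ([_,_])
        open NormalOrder K using (fromℕ) in
    [ w , k ] ≈ fromℕ (c (H w ᵈ) (toℕ k)) × c (H w ᵈ) (toℕ k) ≡ c (G w dyck ᵈ) (toℕ k)
theorem8 K w dyck k =
  CommutativeRing.trans K (normalOrder-coefficient K w k)
    (CommutativeRing.reflexive K (cong (NormalOrder.fromℕ K) (sym c-H))) ,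
  trans c-H (sym c-G)
  where
  c-H : c (H w ᵈ) (toℕ k) ≡ coefficient (heights w) (toℕ k)
  c-H = trans (c-coefficient (H w ᵈ) (ᵈ-irreflexive (H w)) (toℕ k))
    (cong (λ ds → coefficient ds (toℕ k)) (nonNeighbourCounts-H dyck))
  c-G : c (G w dyck ᵈ) (toℕ k) ≡ coefficient (heights w) (toℕ k)
  c-G = trans (c-coefficient (G w dyck ᵈ) (ᵈ-irreflexive (G w dyck)) (toℕ k))
    (cong (λ ds → coefficient ds (toℕ k)) (nonNeighbourCounts-graph (factorise dyck)))
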